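{- The arithmetical theory $B\Sigma_1+\mathsf{exp}$ interprets the set theory $\mathsf{T}_0+\mathsf{PowerSet}+\mathsf{Coll}(\Sigma_1)$.
   Context: Interpretability: for first-order theories $S,T$, "$T$ interprets $S$" means that a fixed finite family of parameter-free formulas in the language of $T$ defines, in every model of $T$, a nonempty quotient structure satisfying $S$; the formulas specify the domain, an equivalence relation on that domain (serving as equality), and the interpretations of the relations and functions of $S$. Arithmetic: $B\Sigma_1$ is $I\Delta_0$ (that is, $\mathsf{PA}^{ - }$ plus induction for bounded arithmetical formulas) together with the collection (bounding) scheme for arithmetical $\Sigma_1$ formulas; $\mathsf{exp}$ asserts that $x\mapsto 2^x$ is total. Set theories are in the first-order language $\{\in\}$. $\Delta_0$ formulas contain only quantifiers $\forall x\in a$, $\exists x\in a$; $\Sigma_n$ and $\Pi_n$ formulas (Lévy hierarchy) are obtained from $\Delta_0$ formulas by strict alternation of unbounded quantifier blocks in prenex form. $\mathsf{S}_0$: Extensionality, Empty Set, Pairing, Set Difference ($x\setminus y$ exists), Union. $\mathsf{ReS}_0=\mathsf{S}_0+$ Separation for $\Delta_0$ formulas. $\mathsf{DB}_0=\mathsf{ReS}_0+$ existence of Cartesian products (with Kuratowski pairs). $\mathsf{GJ}_0=\mathsf{DB}_0+$ the axiom that for all $x,y$ the set $R_8(x,y)=\{x''\{w\}:w\in y\}$ exists, where $x''\{w\}=\{u:\langle u,w\rangle\in x\}$. $\mathsf{T}_0=\mathsf{GJ}_0+\mathsf{SetFoundation}+\mathsf{TCl}$, where $\mathsf{SetFoundation}$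 says that every nonempty set has an $\in$-minimal element and $\mathsf{TCl}$ says that every set is contained in a least transitive set. $\mathsf{PowerSet}$ is the Power Set axiom. $\mathsf{Coll}(\Gamma)$ is the scheme, for every $\varphi\in\Gamma$: $\forall x\in a\,\exists y\,\varphi(x,y,\bar p)\to\exists b\,\forall x\in a\,\exists y\in b\,\varphi(x,y,\bar p)$. -}

module Defs where

open import Data.Empty.Polymorphic using (⊥)
open import Data.Fin using (Fin; zero; suc; _↑ʳ_)
open import Data.Nat using (ℕ; zero; suc; _+_)
open import Data.Product using (Σ; Σ-syntax; ∃-syntax; _×_; proj₁)
open import Data.Vec using (Vec; []; _∷_; lookup; map; tabulate)
open import Data.Vec.Relation.Binary.Pointwise.Inductive using (Pointwise)
open import Function using (_⇔_)
open import Level using (Level; 0ℓ; Setω) renaming (suc to lsuc)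
open import Relation.Binary using (IsEquivalence; Stable)
open import Relation.Nullary using (¬_)
import Relation.Nullary as Nullary
open import Relation.Unary using (Pred; _∈_; _∪_; ｛_｝)

private
  variable
    ℓ : Level
    m n : ℕ

------------------------------------------------------------------------
-- First-order syntax, with well-scoped de Bruijn indices:
-- the most recently bound variable is v0.

record Signature : Set₁ where
  field
    Fun Rel : Set
    arF     : Fun → ℕ
    arR     : Rel → ℕ

open Signature

data Term (L : Signature) (n : ℕ) : Set where
  var : Fin n → Term L n
  fn  : (f : Fun L) → Vec (Term L n) (arF L f) → Term L n

pattern v0 = var zero
pattern v1 = var (suc zero)
pattern v2 = var (suc (suc zero))
pattern v3 = var (suc (suc (suc zero)))

infix  8 _≐_
infixr 7 _∧̇_
infixr 6 _∨̇_
infixr 5 _⇒̇_ _⇔̇_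

data Formula (L : Signature) (n : ℕ) : Set where
  ⊥̇              : Formula L n
  _≐_            : Term L n → Term L n → Formula L n
  rel            : (R : Rel L) → Vec (Term L n) (arR L R) → Formula L n
  _∧̇_ _∨̇_ _⇒̇_ : Formula L n → Formula L n → Formula L n
  ∀̇ ∃̇          : Formula L (suc n) → Formula L n

Sentence : Signature → Set
Sentence L = Formula L 0

Theory : Signature → Set₁
Theory L = Pred (Sentence L) 0ℓ

private
  variable
    L L′ : Signature

¬̇_ : Formula L n → Formula L n
¬̇ φ = φ ⇒̇ ⊥̇

infix 9 ¬̇_

_⇔̇_ : Formula L n → Formula L n → Formula L n
φ ⇔̇ ψ = (φ ⇒̇ ψ) ∧̇ (ψ ⇒̇ φ)

∀* : ∀ n → Formula L n → Sentence L
∀* zero    φ = φ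
∀* (suc n) φ = ∀* n (∀̇ φ)

mutual
  rename : (Fin m → Fin n) → Term L m → Term L n
  rename ρ (var i)   = var (ρ i)
  rename ρ (fn f ts) = fn f (renames ρ ts)

  renames : ∀ {k} → (Fin m → Fin n) → Vec (Term L m) k → Vec (Term L n) k
  renames ρ []       = []
  renames ρ (t ∷ ts) = rename ρ t ∷ renames ρ ts

infixr 25 ↑_

↑_ : Term L n → Term L (suc n)
↑ t = rename suc t

mutual
  substT : Vec (Term L n) m → Term L m → Term L n
  substT σ (var i)   = lookup σ i
  substT σ (fn f ts) = fn f (substTs σ ts)

  substTs : ∀ {k} → Vec (Term L n) m → Vec (Term L m) k → Vec (Term L n) k
  substTs σ []       = []
  substTs σ (t ∷ ts) = substT σ t ∷ substTs σ ts

infix 9 _[_]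

-- Simultaneous capture-avoiding substitution: σ lists the terms put for
-- variables 0, 1, …
_[_] : Formula L m → Vec (Term L n) m → Formula L n
⊥̇        [ σ ] = ⊥̇
(s ≐ t)  [ σ ] = substT σ s ≐ substT σ t
rel R ts [ σ ] = rel R (substTs σ ts)
(φ ∧̇ ψ) [ σ ] = φ [ σ ] ∧̇ ψ [ σ ]
(φ ∨̇ ψ) [ σ ] = φ [ σ ] ∨̇ ψ [ σ ]
(φ ⇒̇ ψ) [ σ ] = φ [ σ ] ⇒̇ ψ [ σ ]
∀̇ φ     [ σ ] = ∀̇ (φ [ v0 ∷ map ↑_ σ ])
∃̇ φ     [ σ ] = ∃̇ (φ [ v0 ∷ map ↑_ σ ])

-- The n outer variables (the parameters of a scheme), seen from under k
-- further quantifiers.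
params : ∀ k → Vec (Term L (k + n)) n
params k = tabulate (λ i → var (k ↑ʳ i))

------------------------------------------------------------------------
-- Classical Tarskian semantics.

-- Structures are taken up to an equality ≈, so that quotients exist.  The
-- two stability fields are automatic under excluded middle; constructively
-- they make the satisfaction relation below obey classical logic.
record Structure (L : Signature) ℓ : Set (lsuc ℓ) where
  infix 4 _≈_
  field
    Carrier       : Set ℓ
    _≈_           : Carrier → Carrier → Set ℓ
    isEquivalence : IsEquivalence _≈_
    ≈-stable      : Stable _≈_
    point         : Carrier
    ⟦fun⟧         : (f : Fun L) → Vec Carrier (arF L f) → Carrier
    ⟦rel⟧         : (R : Rel L) → Vec Carrier (arR L R) → Set ℓ
    fun-cong      : ∀ f {xs ys} → Pointwise _≈_ xs ys → ⟦fun⟧ f xs ≈ ⟦fun⟧ f ys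
    rel-resp      : ∀ R {xs ys} → Pointwise _≈_ xs ys → ⟦rel⟧ R xs → ⟦rel⟧ R ys
    rel-stable    : ∀ R xs → Nullary.Stable (⟦rel⟧ R xs)

open Structure

mutual
  eval : (M : Structure L ℓ) → Vec (Carrier M) n → Term L n → Carrier M
  eval M ρ (var i)   = lookup ρ i
  eval M ρ (fn f ts) = ⟦fun⟧ M f (evals M ρ ts)

  evals : ∀ {k} (M : Structure L ℓ) → Vec (Carrier M) n →
          Vec (Term L n) k → Vec (Carrier M) k
  evals M ρ []       = []
  evals M ρ (t ∷ ts) = eval M ρ t ∷ evals M ρ ts

-- Disjunction and existence are read classically (¬(¬A ∧ ¬B) and ¬∀¬).
Sat : (M : Structure L ℓ) → Vec (Carrier M) n → Formula L n → Set ℓ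
Sat M ρ ⊥̇         = ⊥
Sat M ρ (s ≐ t)   = _≈_ M (eval M ρ s) (eval M ρ t)
Sat M ρ (rel R ts) = ⟦rel⟧ M R (evals M ρ ts)
Sat M ρ (φ ∧̇ ψ)  = Sat M ρ φ × Sat M ρ ψ
Sat M ρ (φ ∨̇ ψ)  = ¬ (¬ Sat M ρ φ × ¬ Sat M ρ ψ)
Sat M ρ (φ ⇒̇ ψ)  = Sat M ρ φ → Sat M ρ ψ
Sat M ρ (∀̇ φ)    = ∀ x → Sat M (x ∷ ρ) φ
Sat M ρ (∃̇ φ)    = ¬ (∀ x → ¬ Sat M (x ∷ ρ) φ)

infix 4 _⊨_

_⊨_ : Structure L ℓ → Theory L → Set ℓ
M ⊨ T = ∀ φ → φ ∈ T → Sat M [] φ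

------------------------------------------------------------------------
-- Interpretations.

-- Parameter-free formulas over L giving a domain, an equality and, for each
-- symbol of L′, its meaning; funF f is the graph, with the value as v0.
record Interpretation (L′ L : Signature) : Set where
  field
    domF : Formula L 1
    eqF  : Formula L 2
    funF : (f : Fun L′) → Formula L (suc (arF L′ f))
    relF : (R : Rel L′) → Formula L (arR L′ R)

-- N is, via quot, the quotient of domF by eqF as computed in M.
record Defines (I : Interpretation L′ L) (M : Structure L ℓ)
               (N : Structure L′ ℓ) : Set ℓ where
  open Interpretation I

  Dom : Set ℓ
  Dom = Σ[ x ∈ Carrier M ] Sat M (x ∷ []) domF

  field
    quot      : Dom → Carrier N
    quot-surj : ∀ y → ∃[ x ] _≈_ N (quot x) y
    quot-eq   : ∀ x y → _≈_ N (quot x) (quot y) ⇔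
                        Sat M (proj₁ x ∷ proj₁ y ∷ []) eqF
    quot-fun  : ∀ f (xs : Vec Dom (arF L′ f)) y →
                _≈_ N (⟦fun⟧ N f (map quot xs)) (quot y) ⇔
                Sat M (proj₁ y ∷ map proj₁ xs) (funF f)
    quot-rel  : ∀ R (xs : Vec Dom (arR L′ R)) →
                ⟦rel⟧ N R (map quot xs) ⇔ Sat M (map proj₁ xs) (relF R)

infix 4 _Interprets_

record _Interprets_ (T : Theory L) (S : Theory L′) : Setω where
  field
    interpretation : Interpretation L′ L
    correct        : ∀ {ℓ} (M : Structure L ℓ) → M ⊨ T →
                     Σ[ N ∈ Structure L′ ℓ ] Defines interpretation M N × N ⊨ S

------------------------------------------------------------------------
-- Bounded formulas, Σ₁ formulas and collection, relative to the binary
-- relation ⊲ that bounds quantifiers (< for arithmetic, ∈ for sets).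

module Bounded {L : Signature}
               (_⊲_ : ∀ {n} → Term L n → Term L n → Formula L n) where

  ∀⊲ ∃⊲ : Term L n → Formula L (suc n) → Formula L n
  ∀⊲ t φ = ∀̇ ((v0 ⊲ ↑ t) ⇒̇ φ)
  ∃⊲ t φ = ∃̇ ((v0 ⊲ ↑ t) ∧̇ φ)

  data Δ₀ {n : ℕ} : Formula L n → Set where
    fls  : Δ₀ ⊥̇
    eq   : ∀ s t → Δ₀ (s ≐ t)
    atom : ∀ R ts → Δ₀ (rel R ts)
    and  : ∀ {φ ψ} → Δ₀ φ → Δ₀ ψ → Δ₀ (φ ∧̇ ψ)
    or   : ∀ {φ ψ} → Δ₀ φ → Δ₀ ψ → Δ₀ (φ ∨̇ ψ)
    imp  : ∀ {φ ψ} → Δ₀ φ → Δ₀ ψ → Δ₀ (φ ⇒̇ ψ)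
    all  : ∀ t {φ} → Δ₀ φ → Δ₀ (∀⊲ t φ)
    ex   : ∀ t {φ} → Δ₀ φ → Δ₀ (∃⊲ t φ)

  data Σ₁ {n : ℕ} : Formula L n → Set where
    bounded : ∀ {φ} → Δ₀ φ → Σ₁ φ
    exists  : ∀ {φ} → Σ₁ φ → Σ₁ (∃̇ φ)

  -- φ has v0 = y, v1 = x, and then n parameters, among whose values the
  -- bound a may occur.
  data Coll (Γ : ∀ {n} → Formula L n → Set) : Theory L where
    coll : ∀ n (φ : Formula L (2 + n)) → Γ φ →
           Coll Γ (∀* n (∀̇ (∀⊲ v0 (∃̇ (φ [ v0 ∷ v1 ∷ params 3 ]))
                            ⇒̇ ∃̇ (∀⊲ v1 (∃⊲ v1 (φ [ v0 ∷ v1 ∷ params 4 ]))))))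

------------------------------------------------------------------------
-- Arithmetic.

data ArithFun : Set where
  zeroS oneS plusS timesS : ArithFun

data ArithRel : Set where
  lessS : ArithRel

𝓛A : Signature
𝓛A = record
  { Fun = ArithFun
  ; Rel = ArithRel
  ; arF = λ { zeroS → 0 ; oneS → 0 ; plusS → 2 ; timesS → 2 }
  ; arR = λ { lessS → 2 }
  }

infixl 11 _+̇_
infixl 12 _*̇_
infix  8 _<̇_

0̇ 1̇ : Term 𝓛A n
0̇ = fn zeroS []
1̇ = fn oneS []

_+̇_ _*̇_ : Term 𝓛A n → Term 𝓛A n → Term 𝓛A n
s +̇ t = fn plusS (s ∷ t ∷ [])
s *̇ t = fn timesS (s ∷ t ∷ [])

_<̇_ : Term 𝓛A n → Term 𝓛A n → Formula 𝓛A n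
s <̇ t = rel lessS (s ∷ t ∷ [])

module Arith = Bounded _<̇_

open Arith using () renaming (∀⊲ to ∀<; ∃⊲ to ∃<)

-- Kaye's axioms: the non-negative part of a discretely ordered ring.
data PA⁻ : Theory 𝓛A where
  +-assoc  : PA⁻ (∀* 3 ((v0 +̇ v1) +̇ v2 ≐ v0 +̇ (v1 +̇ v2)))
  +-comm   : PA⁻ (∀* 2 (v0 +̇ v1 ≐ v1 +̇ v0))
  *-assoc  : PA⁻ (∀* 3 ((v0 *̇ v1) *̇ v2 ≐ v0 *̇ (v1 *̇ v2)))
  *-comm   : PA⁻ (∀* 2 (v0 *̇ v1 ≐ v1 *̇ v0))
  distrib  : PA⁻ (∀* 3 (v0 *̇ (v1 +̇ v2) ≐ v0 *̇ v1 +̇ v0 *̇ v2))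
  +-zero   : PA⁻ (∀* 1 (v0 +̇ 0̇ ≐ v0))
  *-zero   : PA⁻ (∀* 1 (v0 *̇ 0̇ ≐ 0̇))
  *-one    : PA⁻ (∀* 1 (v0 *̇ 1̇ ≐ v0))
  <-trans  : PA⁻ (∀* 3 (v0 <̇ v1 ∧̇ v1 <̇ v2 ⇒̇ v0 <̇ v2))
  <-irrefl : PA⁻ (∀* 1 (¬̇ (v0 <̇ v0)))
  <-total  : PA⁻ (∀* 2 (v0 <̇ v1 ∨̇ v0 ≐ v1 ∨̇ v1 <̇ v0))
  +-mono   : PA⁻ (∀* 3 (v0 <̇ v1 ⇒̇ v0 +̇ v2 <̇ v1 +̇ v2))
  *-mono   : PA⁻ (∀* 3 (0̇ <̇ v2 ∧̇ v0 <̇ v1 ⇒̇ v0 *̇ v2 <̇ v1 *̇ v2))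
  <-diff   : PA⁻ (∀* 2 (v0 <̇ v1 ⇒̇ ∃̇ (v1 +̇ v0 ≐ v2)))
  0<1      : PA⁻ (0̇ <̇ 1̇)
  discrete : PA⁻ (∀* 1 (0̇ <̇ v0 ⇒̇ 1̇ <̇ v0 ∨̇ 1̇ ≐ v0))
  0-least  : PA⁻ (∀* 1 (0̇ <̇ v0 ∨̇ 0̇ ≐ v0))

data Δ₀-Induction : Theory 𝓛A where
  ind : ∀ n (φ : Formula 𝓛A (1 + n)) → Arith.Δ₀ φ →
        Δ₀-Induction
          (∀* n (φ [ 0̇ ∷ params 0 ] ∧̇ ∀̇ (φ ⇒̇ φ [ v0 +̇ 1̇ ∷ params 1 ]) ⇒̇ ∀̇ φ))

IΔ₀ BΣ₁ : Theory 𝓛A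
IΔ₀ = PA⁻ ∪ Δ₀-Induction
BΣ₁ = IΔ₀ ∪ Arith.Coll Arith.Σ₁

-- Gödel's β-function: r is the remainder of a modulo 1 + (i + 1) * b.
Beta : (a b i r : Term 𝓛A n) → Formula 𝓛A n
Beta a b i r =
  r <̇ modulus ∧̇ ∃< (a +̇ 1̇) (↑ a ≐ v0 *̇ ↑ modulus +̇ ↑ r)
  where modulus = 1̇ +̇ (i +̇ 1̇) *̇ b

-- y = 2^x: some pair a, b β-codes a sequence which starts with 1, doubles at
-- each of x steps, and ends with y.  Over IΔ₀, totality of this Σ₁ graph is
-- equivalent to totality of the usual Δ₀-definable one.
PowerOfTwo : (x y : Term 𝓛A n) → Formula 𝓛A n
PowerOfTwo x y = ∃̇ (∃̇
  ( Beta v1 v0 0̇ 1̇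
  ∧̇ ∀< (↑ ↑ x) (∃< (v2 +̇ 1̇) (Beta v3 v2 v1 v0 ∧̇ Beta v3 v2 (v1 +̇ 1̇) (v0 +̇ v0)))
  ∧̇ Beta v1 v0 (↑ ↑ x) (↑ ↑ y)))

exp : Sentence 𝓛A
exp = ∀̇ (∃̇ (PowerOfTwo v1 v0))

------------------------------------------------------------------------
-- Set theory.

data SetFun : Set where

data SetRel : Set where
  memS : SetRel

𝓛∈ : Signature
𝓛∈ = record
  { Fun = SetFun
  ; Rel = SetRel
  ; arF = λ ()
  ; arR = λ { memS → 2 }
  }

infix 8 _∈̇_ _⊆̇_ _≐｛_｝

_∈̇_ : Term 𝓛∈ n → Term 𝓛∈ n → Formula 𝓛∈ n
s ∈̇ t = rel memS (s ∷ t ∷ [])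

-- The only terms of 𝓛∈ are variables, so this is the Lévy hierarchy.
module Sets = Bounded _∈̇_

open Sets using () renaming (∀⊲ to ∀∈; ∃⊲ to ∃∈)

_⊆̇_ : Term 𝓛∈ n → Term 𝓛∈ n → Formula 𝓛∈ n
s ⊆̇ t = ∀∈ s (v0 ∈̇ ↑ t)

Transitive : Term 𝓛∈ n → Formula 𝓛∈ n
Transitive t = ∀∈ t (v0 ⊆̇ ↑ t)

-- z = {x : φ(x)}, with x as v0 in φ.
_≐｛_｝ : Term 𝓛∈ n → Formula 𝓛∈ (suc n) → Formula 𝓛∈ n
z ≐｛ φ ｝ = ∀̇ (v0 ∈̇ ↑ z ⇔̇ φ)

-- w = ⟨u, v⟩ = {{u}, {u, v}}.
IsPair : (w u v : Term 𝓛∈ n) → Formula 𝓛∈ n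
IsPair w u v =
  w ≐｛ v0 ≐｛ v0 ≐ ↑ ↑ u ｝ ∨̇ v0 ≐｛ v0 ≐ ↑ ↑ u ∨̇ v0 ≐ ↑ ↑ v ｝ ｝

-- t = x''{w} = {u : ⟨u, w⟩ ∈ x}.
IsImage : (t x w : Term 𝓛∈ n) → Formula 𝓛∈ n
IsImage t x w = t ≐｛ ∃∈ (↑ x) (IsPair v0 v1 (↑ ↑ w)) ｝

Extensionality EmptySet Pairing SetDifference Union CartesianProduct R₈
  SetFoundation TCl PowerSet : Sentence 𝓛∈

Extensionality   = ∀̇ (∀̇ (∀̇ (v0 ∈̇ v2 ⇔̇ v0 ∈̇ v1) ⇒̇ v1 ≐ v0))
EmptySet         = ∃̇ (v0 ≐｛ ⊥̇ ｝)
Pairing          = ∀̇ (∀̇ (∃̇ (v0 ≐｛ v0 ≐ v3 ∨̇ v0 ≐ v2 ｝)))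
SetDifference    = ∀̇ (∀̇ (∃̇ (v0 ≐｛ v0 ∈̇ v3 ∧̇ ¬̇ (v0 ∈̇ v2) ｝)))
Union            = ∀̇ (∃̇ (v0 ≐｛ ∃∈ v2 (v1 ∈̇ v0) ｝))
CartesianProduct = ∀̇ (∀̇ (∃̇ (v0 ≐｛ ∃∈ v3 (∃∈ v3 (IsPair v2 v1 v0)) ｝)))
R₈               = ∀̇ (∀̇ (∃̇ (v0 ≐｛ ∃∈ v2 (IsImage v1 (↑ v3) v0) ｝)))
SetFoundation    = ∀̇ (∃̇ (v0 ∈̇ v1) ⇒̇ ∃∈ v0 (∀∈ v1 (¬̇ (v0 ∈̇ v1))))
TCl              = ∀̇ (∃̇ (v1 ⊆̇ v0 ∧̇ Transitive v0
                         ∧̇ ∀̇ (v2 ⊆̇ v0 ∧̇ Transitive v0 ⇒̇ v1 ⊆̇ v0)))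
PowerSet         = ∀̇ (∃̇ (v0 ≐｛ v0 ⊆̇ v2 ｝))

-- φ has v0 = x and then n parameters.
data Δ₀-Separation : Theory 𝓛∈ where
  sep : ∀ n (φ : Formula 𝓛∈ (1 + n)) → Sets.Δ₀ φ →
        Δ₀-Separation
          (∀* n (∀̇ (∃̇ (v0 ≐｛ v0 ∈̇ v2 ∧̇ φ [ v0 ∷ params 3 ] ｝))))

S₀ ReS₀ DB₀ GJ₀ T₀ : Theory 𝓛∈
S₀   = ｛ Extensionality ｝ ∪ ｛ EmptySet ｝ ∪ ｛ Pairing ｝ ∪ ｛ SetDifference ｝
       ∪ ｛ Union ｝
ReS₀ = S₀ ∪ Δ₀-Separation
DB₀  = ReS₀ ∪ ｛ CartesianProduct ｝
GJ₀  = DB₀ ∪ ｛ R₈ ｝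
T₀   = GJ₀ ∪ ｛ SetFoundation ｝ ∪ ｛ TCl ｝

{-# OPTIONS --safe #-}

-- Ackermann's interpretation: sets are numbers, and x ∈ y holds when the x-th
-- binary digit of y is 1.  No Δ₀ definition of x ↦ 2^x is used: as the graph of
-- exponentiation is Σ₁ and functional, it is Δ₁, and so is membership.  BΣ₁
-- shows that bounded formulas in Δ₁ predicates are again Δ₁ and that they obey
-- induction: collection bounds the witnesses below a given number, which turns
-- such a formula into a bounded one.  By induction every such formula φ and
-- every a have a code of {x < a : φ}; together with "z ⊆ y implies z ≤ y" this
-- gives all the set existence axioms, since each required set has elements
-- below a bound that can be named.  Σ₁ collection for sets is Σ₁ collection for
-- numbers, as {x : x < b} is a set.
--
-- Satisfaction reads ∨ and ∃ classically, so existence is proved in the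
-- double-negation monad.

module Submission where

open import Algebra.Bundles using (CommutativeSemiring)
import Algebra.Solver.Ring.NaturalCoefficients.Default as NatSolver
open import Algebra.Structures.Biased using (isCommutativeSemiringˡ)
import Data.Empty.Polymorphic as Poly
open import Data.Fin using (Fin; zero; suc; _↑ʳ_; fromℕ; inject₁; lift; #_)
open import Data.Nat using (ℕ; zero; suc) renaming (_+_ to _+ℕ_)
open import Data.Product using (Σ; Σ-syntax; _×_; _,_; proj₁; proj₂; uncurry)
open import Data.Sum using (_⊎_; inj₁; inj₂)
open import Data.Vec using (Vec; []; _∷_; _++_; _∷ʳ_; lookup; map; tabulate)
open import Data.Vec.Properties
  using (lookup-map; lookup-++ʳ; tabulate∘lookup; lookup∘tabulate)
open import Data.Vec.Relation.Binary.Pointwise.Inductive as Pointwise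
  using (Pointwise; []; _∷_)
open import Function using (_⇔_; mk⇔; _∘_; id; Equivalence)
open import Level using (Level)
open import Relation.Binary using (module IsEquivalence)
open import Relation.Binary.PropositionalEquality
  using (_≡_; refl; sym; trans; cong; cong₂; subst)
open import Relation.Nullary using (¬_; Stable; contradiction)
open import Relation.Nullary.Negation using (negated-stable)

open import Defs
  hiding (+-assoc; +-comm; *-assoc; *-comm; <-trans; <-irrefl; <-diff; 0<1)
open import Relation.Unary using (_∪_; ｛_｝)

open Arith using (Δ₀) renaming (∀⊲ to ∀<; ∃⊲ to ∃<)

private
  variable
    ℓ ℓ′ : Level
    A : Set ℓ
    L : Signature
    k m n : ℕ

-- Classical reasoning under double negation

infixl 1 _>>=_

_>>=_ : {A : Set ℓ} {B : Set ℓ′} → ¬ ¬ A → (A → ¬ ¬ B) → ¬ ¬ B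
(p >>= f) ¬B = p λ x → f x ¬B

pure : {A : Set ℓ} → A → ¬ ¬ A
pure = contradiction

lem : (A : Set ℓ) → ¬ ¬ (A ⊎ ¬ A)
lem A k = k (inj₂ (k ∘ inj₁))

-- The reading that `Sat` gives to the existential quantifier, so that semantic statements and
-- satisfied formulas agree definitionally.
Ex : {A : Set ℓ} → (A → Set ℓ′) → Set _
Ex {A = A} P = ¬ (∀ x → ¬ P x)

some : {A : Set ℓ} {P : A → Set ℓ′} → Ex P → ¬ ¬ Σ A P
some h k = h λ x p → k (x , p)

exists : {A : Set ℓ} {P : A → Set ℓ′} → ¬ ¬ Σ A P → Ex P
exists h k = h (uncurry k)

cases : {A : Set ℓ} {B : Set ℓ′} → ¬ (¬ A × ¬ B) → ¬ ¬ (A ⊎ B)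
cases h k = h (k ∘ inj₁ , k ∘ inj₂)

uncases : {A : Set ℓ} {B : Set ℓ′} → ¬ ¬ (A ⊎ B) → ¬ (¬ A × ¬ B)
uncases h (na , nb) = h λ { (inj₁ x) → na x ; (inj₂ y) → nb y }

absurd : {A : Set ℓ′} → Poly.⊥ {ℓ} → A
absurd ()

refute : {A : Set ℓ′} → (A → Poly.⊥ {ℓ}) → ¬ A
refute f x = absurd (f x)

-- Substitution and satisfaction

mutual
  substT-rename : ∀ {m′ n′} {f : Fin m → Fin m′} {g : Fin n → Fin n′}
                  {τ : Vec (Term L n′) m′} {σ : Vec (Term L n) m} →
                  (∀ i → lookup τ (f i) ≡ rename g (lookup σ i)) →
                  ∀ t → substT τ (rename f t) ≡ rename g (substT σ t)
  substT-rename h (var i)   = h i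
  substT-rename h (fn f ts) = cong (fn f) (substTs-renames h ts)

  substTs-renames : ∀ {m′ n′} {f : Fin m → Fin m′} {g : Fin n → Fin n′}
                    {τ : Vec (Term L n′) m′} {σ : Vec (Term L n) m} →
                    (∀ i → lookup τ (f i) ≡ rename g (lookup σ i)) →
                    ∀ (ts : Vec (Term L m) k) →
                    substTs τ (renames f ts) ≡ renames g (substTs σ ts)
  substTs-renames h []       = refl
  substTs-renames h (t ∷ ts) = cong₂ _∷_ (substT-rename h t) (substTs-renames h ts)

substT-↑ : ∀ (σ : Vec (Term L n) m) t →
           substT (v0 ∷ map ↑_ σ) (↑ t) ≡ ↑ substT σ t
substT-↑ σ = substT-rename λ i → lookup-map i ↑_ σ

-- `Δ₀` recognises a quantifier as bounded only if its bound is literally a weakened term;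
-- `substT-↑` restores that form once the substitution has passed under the binder.
Δ₀-[] : ∀ {φ : Formula 𝓛A m} → Arith.Δ₀ φ →
        (σ : Vec (Term 𝓛A n) m) → Arith.Δ₀ (φ [ σ ])
Δ₀-[] Arith.fls         σ = Arith.fls
Δ₀-[] (Arith.eq s t)    σ = Arith.eq _ _
Δ₀-[] (Arith.atom R ts) σ = Arith.atom R _
Δ₀-[] (Arith.and δ ε)   σ = Arith.and (Δ₀-[] δ σ) (Δ₀-[] ε σ)
Δ₀-[] (Arith.or δ ε)    σ = Arith.or (Δ₀-[] δ σ) (Δ₀-[] ε σ)
Δ₀-[] (Arith.imp δ ε)   σ = Arith.imp (Δ₀-[] δ σ) (Δ₀-[] ε σ)
Δ₀-[] (Arith.all t δ)   σ =
  subst (λ s → Arith.Δ₀ (∀̇ ((v0 <̇ s) ⇒̇ _))) (sym (substT-↑ σ t))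
    (Arith.all (substT σ t) (Δ₀-[] δ _))
Δ₀-[] (Arith.ex t δ)    σ =
  subst (λ s → Arith.Δ₀ (∃̇ ((v0 <̇ s) ∧̇ _))) (sym (substT-↑ σ t))
    (Arith.ex (substT σ t) (Δ₀-[] δ _))

module Semantics {L : Signature} (M : Structure L ℓ) where
  open Structure M
  open Equivalence

  private
    module ≈ = IsEquivalence isEquivalence

  -- Disjunction and existence are negations already, and atoms are stable by the fields of
  -- `Structure`. Hence any satisfaction goal may be proved in the double-negation monad.
  Sat-stable : ∀ (φ : Formula L n) {ρ} → Stable (Sat M ρ φ)
  Sat-stable ⊥̇          h = contradiction (λ ()) h
  Sat-stable (s ≐ t)    h = ≈-stable _ _ h
  Sat-stable (rel R ts) h = rel-stable R _ h
  Sat-stable (φ ∧̇ ψ)   h = Sat-stable φ (h >>= pure ∘ proj₁) ,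
                            Sat-stable ψ (h >>= pure ∘ proj₂)
  Sat-stable (φ ∨̇ ψ)   h = negated-stable h
  Sat-stable (φ ⇒̇ ψ)   h x = Sat-stable ψ (h >>= λ f → pure (f x))
  Sat-stable (∀̇ φ)     h x = Sat-stable φ (h >>= λ f → pure (f x))
  Sat-stable (∃̇ φ)     h = negated-stable h

  mutual
    eval-resp : ∀ {ρ ρ′ : Vec Carrier n} → Pointwise _≈_ ρ ρ′ →
                ∀ t → eval M ρ t ≈ eval M ρ′ t
    eval-resp p (var i)   = Pointwise.lookup p i
    eval-resp p (fn f ts) = fun-cong f (evals-resp p ts)

    evals-resp : ∀ {ρ ρ′ : Vec Carrier n} → Pointwise _≈_ ρ ρ′ →
                 ∀ (ts : Vec (Term L n) k) →
                 Pointwise _≈_ (evals M ρ ts) (evals M ρ′ ts)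
    evals-resp p []       = []
    evals-resp p (t ∷ ts) = eval-resp p t ∷ evals-resp p ts

  Sat-resp : ∀ (φ : Formula L n) {ρ ρ′} → Pointwise _≈_ ρ ρ′ →
             Sat M ρ φ → Sat M ρ′ φ
  Sat-resp ⊥̇          p h = h
  Sat-resp (s ≐ t)    p h =
    ≈.trans (≈.sym (eval-resp p s)) (≈.trans h (eval-resp p t))
  Sat-resp (rel R ts) p h = rel-resp R (evals-resp p ts) h
  Sat-resp (φ ∧̇ ψ)   p (h , k) = Sat-resp φ p h , Sat-resp ψ p k
  Sat-resp (φ ∨̇ ψ)   p h (¬φ , ¬ψ) = h (¬φ ∘ Sat-resp φ p , ¬ψ ∘ Sat-resp ψ p)
  Sat-resp (φ ⇒̇ ψ)   p h x =
    Sat-resp ψ p (h (Sat-resp φ (Pointwise.sym ≈.sym p) x))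
  Sat-resp (∀̇ φ)     p h x = Sat-resp φ (≈.refl ∷ p) (h x)
  Sat-resp (∃̇ φ)     p h k = h λ x y → k x (Sat-resp φ (≈.refl ∷ p) y)

  mutual
    eval-rename : ∀ {f : Fin m → Fin n} {ρ ρ′} →
                  (∀ i → lookup ρ′ (f i) ≡ lookup ρ i) →
                  ∀ t → eval M ρ′ (rename f t) ≡ eval M ρ t
    eval-rename h (var i)   = h i
    eval-rename h (fn f ts) = cong (⟦fun⟧ f) (evals-renames h ts)

    evals-renames : ∀ {f : Fin m → Fin n} {ρ ρ′} →
                    (∀ i → lookup ρ′ (f i) ≡ lookup ρ i) →
                    ∀ (ts : Vec (Term L m) k) →
                    evals M ρ′ (renames f ts) ≡ evals M ρ ts
    evals-renames h []       = refl
    evals-renames h (t ∷ ts) = cong₂ _∷_ (eval-rename h t) (evals-renames h ts)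

  eval-↑ : ∀ {x} {ρ : Vec Carrier n} t → eval M (x ∷ ρ) (↑ t) ≡ eval M ρ t
  eval-↑ = eval-rename λ _ → refl

  evals-map-↑ : ∀ {x} {ρ : Vec Carrier n} (σ : Vec (Term L n) k) →
                evals M (x ∷ ρ) (map ↑_ σ) ≡ evals M ρ σ
  evals-map-↑ []      = refl
  evals-map-↑ (t ∷ σ) = cong₂ _∷_ (eval-↑ t) (evals-map-↑ σ)

  eval-lookup : ∀ {ρ : Vec Carrier n} (σ : Vec (Term L n) m) i →
                eval M ρ (lookup σ i) ≡ lookup (evals M ρ σ) i
  eval-lookup (t ∷ σ) zero    = refl
  eval-lookup (t ∷ σ) (suc i) = eval-lookup σ i

  mutual
    eval-subst : ∀ {ρ : Vec Carrier n} (σ : Vec (Term L n) m) t →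
                 eval M ρ (substT σ t) ≡ eval M (evals M ρ σ) t
    eval-subst σ (var i)   = eval-lookup σ i
    eval-subst σ (fn f ts) = cong (⟦fun⟧ f) (evals-subst σ ts)

    evals-subst : ∀ {ρ : Vec Carrier n} (σ : Vec (Term L n) m)
                  (ts : Vec (Term L m) k) →
                  evals M ρ (substTs σ ts) ≡ evals M (evals M ρ σ) ts
    evals-subst σ []       = refl
    evals-subst σ (t ∷ ts) = cong₂ _∷_ (eval-subst σ t) (evals-subst σ ts)

  Sat-subst : ∀ (φ : Formula L m) (σ : Vec (Term L n) m) {ρ} →
              Sat M ρ (φ [ σ ]) ⇔ Sat M (evals M ρ σ) φ
  Sat-subst-binder : ∀ (φ : Formula L (suc m)) (σ : Vec (Term L n) m) {x ρ} →
                     Sat M (x ∷ ρ) (φ [ v0 ∷ map ↑_ σ ]) ⇔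
                     Sat M (x ∷ evals M ρ σ) φ

  Sat-subst ⊥̇          σ = mk⇔ id id
  Sat-subst (s ≐ t)    σ {ρ}
    rewrite eval-subst {ρ = ρ} σ s | eval-subst {ρ = ρ} σ t = mk⇔ id id
  Sat-subst (rel R ts) σ {ρ}
    rewrite evals-subst {ρ = ρ} σ ts = mk⇔ id id
  Sat-subst (φ ∧̇ ψ)   σ = mk⇔
    (λ (h , k) → to (Sat-subst φ σ) h , to (Sat-subst ψ σ) k)
    (λ (h , k) → from (Sat-subst φ σ) h , from (Sat-subst ψ σ) k)
  Sat-subst (φ ∨̇ ψ)   σ = mk⇔
    (λ h (p , q) → h (p ∘ to (Sat-subst φ σ) , q ∘ to (Sat-subst ψ σ)))
    (λ h (p , q) → h (p ∘ from (Sat-subst φ σ) , q ∘ from (Sat-subst ψ σ)))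
  Sat-subst (φ ⇒̇ ψ)   σ = mk⇔
    (λ h x → to (Sat-subst ψ σ) (h (from (Sat-subst φ σ) x)))
    (λ h x → from (Sat-subst ψ σ) (h (to (Sat-subst φ σ) x)))
  Sat-subst (∀̇ φ)     σ = mk⇔
    (λ h x → to (Sat-subst-binder φ σ) (h x))
    (λ h x → from (Sat-subst-binder φ σ) (h x))
  Sat-subst (∃̇ φ)     σ = mk⇔
    (λ h k → h λ x → k x ∘ to (Sat-subst-binder φ σ))
    (λ h k → h λ x → k x ∘ from (Sat-subst-binder φ σ))

  Sat-subst-binder φ σ {x} {ρ} =
    subst (λ τ → Sat M (x ∷ ρ) (φ [ v0 ∷ map ↑_ σ ]) ⇔ Sat M (x ∷ τ) φ)
          (evals-map-↑ σ) (Sat-subst φ (v0 ∷ map ↑_ σ))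

  evals-tabulate : ∀ {ρ : Vec Carrier n} (f : Fin m → Fin n) {τ} →
                   (∀ i → lookup ρ (f i) ≡ lookup τ i) →
                   evals M ρ (tabulate (λ i → var (f i))) ≡ τ
  evals-tabulate f {[]}    h = refl
  evals-tabulate f {x ∷ τ} h =
    cong₂ _∷_ (h zero) (evals-tabulate (f ∘ suc) (h ∘ suc))

  evals-params : ∀ (xs : Vec Carrier k) {ρ : Vec Carrier n} →
                 evals M (xs ++ ρ) (params k) ≡ ρ
  evals-params xs {ρ} = evals-tabulate (_ ↑ʳ_) (lookup-++ʳ xs ρ)

  Sat-subst-≡ : ∀ (φ : Formula L m) (σ : Vec (Term L n) m) {ρ τ} →
                evals M ρ σ ≡ τ → Sat M ρ (φ [ σ ]) ⇔ Sat M τ φ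
  Sat-subst-≡ φ σ refl = Sat-subst φ σ

  ∀*-elim : ∀ n {φ : Formula L n} → Sat M [] (∀* n φ) → ∀ ρ → Sat M ρ φ
  ∀*-elim zero    h []      = h
  ∀*-elim (suc n) h (x ∷ ρ) = ∀*-elim n h ρ x

  ∀*-intro : ∀ n {φ : Formula L n} → (∀ ρ → Sat M ρ φ) → Sat M [] (∀* n φ)
  ∀*-intro zero    h = h []
  ∀*-intro (suc n) h = ∀*-intro n λ ρ x → h (x ∷ ρ)

-- Ordered semirings

module Ordered (M : Structure 𝓛A ℓ) (M⊨PA⁻ : M ⊨ PA⁻) where
  open Structure M public using (Carrier; _≈_; ≈-stable; isEquivalence)
  open Structure M using (⟦fun⟧; ⟦rel⟧; fun-cong; rel-resp; rel-stable)

  infix  4 _<_ _≤_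
  infixl 6 _+_
  infixl 7 _*_

  0# 1# : Carrier
  0# = ⟦fun⟧ zeroS []
  1# = ⟦fun⟧ oneS []

  _+_ _*_ : Carrier → Carrier → Carrier
  x + y = ⟦fun⟧ plusS (x ∷ y ∷ [])
  x * y = ⟦fun⟧ timesS (x ∷ y ∷ [])

  -- As a negation, `≤` is stable, and a proof of it may assume the opposite strict inequality and
  -- aim at absurdity.
  _<_ _≤_ : Carrier → Carrier → Set _
  x < y = ⟦rel⟧ lessS (x ∷ y ∷ [])
  x ≤ y = ¬ (y < x)

  private
    module ≈ = IsEquivalence isEquivalence
    ax : ∀ {φ} → PA⁻ φ → Sat M [] φ
    ax = M⊨PA⁻ _

  semiring : CommutativeSemiring ℓ ℓ
  semiring = record
    { _+_ = _+_ ; _*_ = _*_ ; 0# = 0# ; 1# = 1#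
    ; isCommutativeSemiring = isCommutativeSemiringˡ record
      { +-isCommutativeMonoid = record
        { isMonoid = record
          { isSemigroup = record
            { isMagma = record
              { isEquivalence = isEquivalence
              ; ∙-cong = λ p q → fun-cong plusS (p ∷ q ∷ []) }
            ; assoc = λ x y z → ax PA⁻.+-assoc z y x }
          ; identity =
              (λ x → ≈.trans (ax PA⁻.+-comm x 0#) (ax PA⁻.+-zero x)) ,
              ax PA⁻.+-zero }
        ; comm = λ x y → ax PA⁻.+-comm y x }
      ; *-isCommutativeMonoid = record
        { isMonoid = record
          { isSemigroup = record
            { isMagma = record
              { isEquivalence = isEquivalence
              ; ∙-cong = λ p q → fun-cong timesS (p ∷ q ∷ []) }
            ; assoc = λ x y z → ax PA⁻.*-assoc z y x }
          ; identity =
              (λ x → ≈.trans (ax PA⁻.*-comm x 1#) (ax PA⁻.*-one x)) ,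
              ax PA⁻.*-one }
        ; comm = λ x y → ax PA⁻.*-comm y x }
      ; distribʳ = λ x y z →
          ≈.trans (ax PA⁻.*-comm x (y + z))
            (≈.trans (ax PA⁻.distrib z y x)
              (fun-cong plusS (ax PA⁻.*-comm y x ∷ ax PA⁻.*-comm z x ∷ [])))
      ; zeroˡ = λ x → ≈.trans (ax PA⁻.*-comm x 0#) (ax PA⁻.*-zero x) }
    }

  open CommutativeSemiring semiring public
    using ( +-cong; +-congˡ; +-congʳ; *-congʳ; +-comm; *-comm; +-identityˡ
          ; +-identityʳ; *-identityˡ; zeroˡ; distribʳ )
    renaming (refl to ≈-refl; sym to ≈-sym; trans to ≈-trans)

  module Solve = NatSolver semiring

  private
    variable
      u v w x y z : Carrier

  <-stable : Stable (x < y)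
  <-stable = rel-stable lessS _

  <-resp : x ≈ u → y ≈ v → x < y → u < v
  <-resp p q = rel-resp lessS (p ∷ q ∷ [])

  <-respˡ : x ≈ u → x < y → u < y
  <-respˡ p = <-resp p ≈-refl

  <-respʳ : y ≈ v → x < y → x < v
  <-respʳ = <-resp ≈-refl

  <-trans : x < y → y < z → x < z
  <-trans p q = ax PA⁻.<-trans _ _ _ (p , q)

  <-irrefl : ¬ (x < x)
  <-irrefl p = absurd (ax PA⁻.<-irrefl _ p)

  <⇒≉ : x < y → ¬ (x ≈ y)
  <⇒≉ p q = <-irrefl (<-respˡ q p)

  tri : ∀ x y → ¬ ¬ (x < y ⊎ x ≈ y ⊎ y < x)
  tri x y = cases (ax PA⁻.<-total y x) >>= λ where
    (inj₁ p) → pure (inj₁ p)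
    (inj₂ h) → cases h >>= λ where
      (inj₁ p) → pure (inj₂ (inj₁ p))
      (inj₂ p) → pure (inj₂ (inj₂ p))

  ≤-resp : x ≈ u → y ≈ v → x ≤ y → u ≤ v
  ≤-resp p q h k = h (<-resp (≈-sym q) (≈-sym p) k)

  ≤-respˡ : x ≈ u → x ≤ y → u ≤ y
  ≤-respˡ p = ≤-resp p ≈-refl

  ≤-respʳ : y ≈ v → x ≤ y → x ≤ v
  ≤-respʳ = ≤-resp ≈-refl

  ≤-reflexive : x ≈ y → x ≤ y
  ≤-reflexive p q = <⇒≉ q (≈-sym p)

  <⇒≤ : x < y → x ≤ y
  <⇒≤ p q = <-irrefl (<-trans p q)

  compare : ∀ x y → ¬ ¬ (x < y ⊎ y ≤ x)
  compare x y = lem (x < y)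

  ≤-split : x ≤ y → ¬ ¬ (x < y ⊎ x ≈ y)
  ≤-split {x} {y} h = tri x y >>= λ where
    (inj₁ p)        → pure (inj₁ p)
    (inj₂ (inj₁ p)) → pure (inj₂ p)
    (inj₂ (inj₂ p)) → contradiction p h

  <-≤-trans : x < y → y ≤ z → x < z
  <-≤-trans p q = <-stable (≤-split q >>= λ where
    (inj₁ r) → pure (<-trans p r)
    (inj₂ r) → pure (<-respʳ r p))

  ≤-<-trans : x ≤ y → y < z → x < z
  ≤-<-trans p q = <-stable (≤-split p >>= λ where
    (inj₁ r) → pure (<-trans r q)
    (inj₂ r) → pure (<-respˡ (≈-sym r) q))

  ≤-trans : x ≤ y → y ≤ z → x ≤ z
  ≤-trans p q r = p (≤-<-trans q r)

  ≤-antisym : x ≤ y → y ≤ x → x ≈ y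
  ≤-antisym {x} {y} p q = ≈-stable _ _ (tri x y >>= λ where
    (inj₁ r)        → contradiction r q
    (inj₂ (inj₁ r)) → pure r
    (inj₂ (inj₂ r)) → contradiction r p)

  0≤ : 0# ≤ x
  0≤ {x} p = cases (ax PA⁻.0-least x) λ where
    (inj₁ q) → <-irrefl (<-trans p q)
    (inj₂ q) → <-irrefl (<-respʳ q p)

  0<1 : 0# < 1#
  0<1 = ax PA⁻.0<1

  0<⇒1≤ : 0# < x → 1# ≤ x
  0<⇒1≤ p q = cases (ax PA⁻.discrete _ p) λ where
    (inj₁ r) → <-irrefl (<-trans r q)
    (inj₂ r) → <⇒≉ q (≈-sym r)

  +-monoˡ-< : x < y → x + z < y + z
  +-monoˡ-< p = ax PA⁻.+-mono _ _ _ p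

  +-monoʳ-< : x < y → z + x < z + y
  +-monoʳ-< p = <-resp (+-comm _ _) (+-comm _ _) (+-monoˡ-< p)

  +-cancelˡ-< : z + x < z + y → x < y
  +-cancelˡ-< {z} {x} {y} p = <-stable (tri x y >>= λ where
    (inj₁ q)        → pure q
    (inj₂ (inj₁ q)) → contradiction (+-congˡ q) (<⇒≉ p)
    (inj₂ (inj₂ q)) → contradiction p (<⇒≤ (+-monoʳ-< q)))

  +-monoˡ-≤ : x ≤ y → x + z ≤ y + z
  +-monoˡ-≤ p q = p (+-cancelˡ-< (<-resp (+-comm _ _) (+-comm _ _) q))

  +-monoʳ-≤ : x ≤ y → z + x ≤ z + y
  +-monoʳ-≤ p q = p (+-cancelˡ-< q)

  +-cancelˡ-≈ : z + x ≈ z + y → x ≈ y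
  +-cancelˡ-≈ p =
    ≤-antisym (λ q → <⇒≉ (+-monoʳ-< q) (≈-sym p)) (λ q → <⇒≉ (+-monoʳ-< q) p)

  m≤m+n : x ≤ x + y
  m≤m+n = ≤-respˡ (+-identityʳ _) (+-monoʳ-≤ 0≤)

  m≤n+m : x ≤ y + x
  m≤n+m = ≤-respʳ (+-comm _ _) m≤m+n

  m<m+n : 0# < y → x < x + y
  m<m+n p = <-respˡ (+-identityʳ _) (+-monoʳ-< p)

  m<m+1 : x < x + 1#
  m<m+1 = m<m+n 0<1

  <-diff : x < y → ¬ ¬ (Σ[ d ∈ Carrier ] 0# < d × x + d ≈ y)
  <-diff p = some (ax PA⁻.<-diff _ _ p) >>= λ (d , q) →
    ≤-split (0≤ {d}) >>= λ where
      (inj₁ r) → pure (d , r , q)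
      (inj₂ r) → contradiction
        (≈-trans (≈-sym (+-identityʳ _)) (≈-trans (+-congˡ r) q)) (<⇒≉ p)

  ≤-diff : x ≤ y → ¬ ¬ (Σ[ d ∈ Carrier ] x + d ≈ y)
  ≤-diff p = ≤-split p >>= λ where
    (inj₁ q) → <-diff q >>= λ (d , _ , r) → pure (d , r)
    (inj₂ q) → pure (0# , ≈-trans (+-identityʳ _) q)

  <⇒+1≤ : x < y → x + 1# ≤ y
  <⇒+1≤ p q = <-diff p λ (d , 0<d , r) →
    +-monoʳ-≤ (0<⇒1≤ 0<d) (<-respˡ (≈-sym r) q)

  <+1⇒≤ : x < y + 1# → x ≤ y
  <+1⇒≤ p q = <⇒+1≤ q p

  ≤⇒<+1 : x ≤ y → x < y + 1#
  ≤⇒<+1 p = ≤-<-trans p m<m+1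

  *-monoˡ-≤ : x ≤ y → x * z ≤ y * z
  *-monoˡ-≤ {z = z} p q = ≤-diff p λ (d , r) →
    m≤m+n (<-respˡ (≈-trans (*-congʳ (≈-sym r)) (distribʳ _ _ _)) q)

  m≤m*n : 0# < y → x ≤ x * y
  m≤m*n {y} {x} p =
    ≤-resp (*-identityˡ _) (*-comm _ _) (*-monoˡ-≤ (0<⇒1≤ p))

  -- If `q < q′`, then `q * m + r` is below `(q + 1#) * m`, hence below `q′ * m + r′`. So the
  -- quotients agree and cancel.
  remainder-unique : ∀ {m q r q′ r′} → r < m → r′ < m →
                     q * m + r ≈ q′ * m + r′ → r ≈ r′
  remainder-unique {m} {q} {r} {q′} {r′} p p′ h = ≈-stable _ _
    (tri q q′ >>= λ where
      (inj₁ s)        → contradiction h (step s p)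
      (inj₂ (inj₁ s)) → pure (+-cancelˡ-≈ (≈-trans h (+-congʳ (*-congʳ (≈-sym s)))))
      (inj₂ (inj₂ s)) → contradiction (≈-sym h) (step s p′))
    where
    step : ∀ {q r q′ r′} → q < q′ → r < m → ¬ (q * m + r ≈ q′ * m + r′)
    step {q} {r} {q′} {r′} s p h = <⇒≉
      (<-≤-trans (+-monoʳ-< p) (≤-respˡ (≈-trans (distribʳ _ _ _) (+-congˡ (*-identityˡ _)))
        (≤-trans (*-monoˡ-≤ (<⇒+1≤ s)) m≤m+n))) h

-- Σ₁ predicates and Δ₁ induction

lookup-∷ʳ-fromℕ : ∀ (xs : Vec A n) {x} → lookup (xs ∷ʳ x) (fromℕ n) ≡ x
lookup-∷ʳ-fromℕ []       = refl
lookup-∷ʳ-fromℕ (y ∷ xs) = lookup-∷ʳ-fromℕ xs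

lookup-∷ʳ-inject₁ : ∀ (xs : Vec A n) {x} i →
                    lookup (xs ∷ʳ x) (inject₁ i) ≡ lookup xs i
lookup-∷ʳ-inject₁ (y ∷ xs) zero    = refl
lookup-∷ʳ-inject₁ (y ∷ xs) (suc i) = lookup-∷ʳ-inject₁ xs i

module Collection (M : Structure 𝓛A ℓ) (M⊨BΣ₁ : M ⊨ BΣ₁) where
  open Semantics M public
  open Ordered M (λ φ h → M⊨BΣ₁ φ (inj₁ (inj₁ h))) public
  open Equivalence

  Env : ℕ → Set _
  Env n = Vec Carrier n

  evals-∷ʳ : ∀ {ρ : Env n} (ts : Vec (Term 𝓛A n) k) t →
             evals M ρ (ts ∷ʳ t) ≡ evals M ρ ts ∷ʳ eval M ρ t
  evals-∷ʳ []       t = refl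
  evals-∷ʳ (s ∷ ts) t = cong (_ ∷_) (evals-∷ʳ ts t)

  Δ₀-induction : ∀ {φ : Formula 𝓛A (suc n)} → Δ₀ φ → ∀ {ρ} →
                 Sat M (0# ∷ ρ) φ →
                 (∀ x → Sat M (x ∷ ρ) φ → Sat M (x + 1# ∷ ρ) φ) →
                 ∀ x → Sat M (x ∷ ρ) φ
  Δ₀-induction {n} {φ} δ {ρ} base step =
    ∀*-elim n (M⊨BΣ₁ _ (inj₁ (inj₂ (ind n φ δ)))) ρ
      ( from (Sat-subst-≡ φ (0̇ ∷ params 0) (cong (_ ∷_) (evals-params []))) base
      , λ x h → from (Sat-subst-≡ φ (v0 +̇ 1̇ ∷ params 1)
                        (cong (_ ∷_) (evals-params (x ∷ [])))) (step x h))

  Σ₁-collection : ∀ {φ : Formula 𝓛A (suc (suc n))} → Arith.Σ₁ φ → ∀ {ρ a} →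
                  (∀ x → x < a → Ex λ y → Sat M (y ∷ x ∷ ρ) φ) →
                  Ex λ b → ∀ x → x < a → Ex λ y → y < b × Sat M (y ∷ x ∷ ρ) φ
  Σ₁-collection {n} {φ} σ {ρ} {a} h g =
    ∀*-elim n (M⊨BΣ₁ _ (inj₂ (Arith.coll n φ σ))) ρ a
      (λ x x<a k → h x x<a λ y p → k y
        (from (Sat-subst-≡ φ (v0 ∷ v1 ∷ params 3)
          (cong (λ τ → y ∷ x ∷ τ) (evals-params (y ∷ x ∷ a ∷ [])))) p))
      λ b k → g b λ x x<a c → k x x<a λ y (y<b , p) → c y (y<b ,
        to (Sat-subst-≡ φ (v0 ∷ v1 ∷ params 4)
          (cong (λ τ → y ∷ x ∷ τ) (evals-params (y ∷ x ∷ b ∷ a ∷ [])))) p)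

  -- P is ∃w θ with θ bounded; w is the last variable, so that quantifying the
  -- first one commutes with it, and θ is upward closed in w, so that finitely
  -- many witnesses may be replaced by one.
  record Σ₁-Definable {n} (P : Env n → Set ℓ) : Set ℓ where
    field
      θ        : Formula 𝓛A (suc n)
      δ        : Δ₀ θ
      mono     : ∀ {ρ w w′} → w ≤ w′ → Sat M (ρ ∷ʳ w) θ → Sat M (ρ ∷ʳ w′) θ
      sound    : ∀ {ρ} w → Sat M (ρ ∷ʳ w) θ → P ρ
      complete : ∀ {ρ} → P ρ → ¬ ¬ (Σ[ w ∈ Carrier ] Sat M (ρ ∷ʳ w) θ)

  open Σ₁-Definable

  private
    variable
      P Q : Env n → Set ℓ

    W : Term 𝓛A (suc n)
    W {n} = var (fromℕ n)

  Σ₁-resp : (∀ {ρ} → P ρ → Q ρ) → (∀ {ρ} → Q ρ → ¬ ¬ P ρ) →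
            Σ₁-Definable P → Σ₁-Definable Q
  Σ₁-resp f g p = record
    { θ = θ p ; δ = δ p ; mono = λ {ρ} → mono p {ρ} ; sound = λ w h → f (sound p w h)
    ; complete = λ q → g q >>= complete p }

  Σ₁-Δ₀ : {φ : Formula 𝓛A n} → Δ₀ φ → Σ₁-Definable (λ ρ → Sat M ρ φ)
  Σ₁-Δ₀ {n} {φ} d = record
    { θ = φ [ σ ] ; δ = Δ₀-[] d σ
    ; mono = λ {ρ} _ h → from (eqv ρ) (to (eqv ρ) h)
    ; sound = λ w → to (eqv _)
    -- The choice of `0#` is arbitrary, as `σ` leaves the last variable out of `θ`.
    ; complete = λ h → pure (0# , from (eqv _) h) }
    where
    σ : Vec (Term 𝓛A (suc n)) n
    σ = tabulate (λ i → var (inject₁ i))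
    eqv : ∀ ρ {w} → Sat M (ρ ∷ʳ w) (φ [ σ ]) ⇔ Sat M ρ φ
    eqv ρ = Sat-subst-≡ φ σ (evals-tabulate inject₁ (lookup-∷ʳ-inject₁ ρ))

  Σ₁-∧ : Σ₁-Definable P → Σ₁-Definable Q → Σ₁-Definable (λ ρ → P ρ × Q ρ)
  Σ₁-∧ p q = record
    { θ = θ p ∧̇ θ q ; δ = Arith.and (δ p) (δ q)
    ; mono = λ {ρ} l (h , k) → mono p {ρ} l h , mono q {ρ} l k
    ; sound = λ w (h , k) → sound p w h , sound q w k
    ; complete = λ {ρ} (h , k) → complete p h >>= λ (w , h′) →
        complete q k >>= λ (w′ , k′) →
        -- The sum is above both witnesses, and `mono` raises each of them to it.
        pure (w + w′ , mono p {ρ} m≤m+n h′ , mono q {ρ} m≤n+m k′) }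

  Σ₁-∨ : Σ₁-Definable P → Σ₁-Definable Q → Σ₁-Definable (λ ρ → ¬ ¬ (P ρ ⊎ Q ρ))
  Σ₁-∨ p q = record
    { θ = θ p ∨̇ θ q ; δ = Arith.or (δ p) (δ q)
    ; mono = λ {ρ} l h (f , g) → h (f ∘ mono p {ρ} l , g ∘ mono q {ρ} l)
    ; sound = λ w h → cases h >>= λ where
        (inj₁ h′) → pure (inj₁ (sound p w h′))
        (inj₂ h′) → pure (inj₂ (sound q w h′))
    ; complete = λ h → h >>= λ where
        (inj₁ h′) → complete p h′ >>= λ (w , k) → pure (w , uncases (pure (inj₁ k)))
        (inj₂ h′) → complete q h′ >>= λ (w , k) → pure (w , uncases (pure (inj₂ k))) }

  module _ {ρ : Env n} {w x : Carrier} where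
    W-intro : x < w → x < eval M (x ∷ (ρ ∷ʳ w)) (↑ W)
    W-intro = subst (x <_) (sym (lookup-∷ʳ-fromℕ ρ))

    W-elim : x < eval M (x ∷ (ρ ∷ʳ w)) (↑ W) → x < w
    W-elim = subst (x <_) (lookup-∷ʳ-fromℕ ρ)

  -- Two unbounded quantifiers merge into one: the same `w` strictly bounds `x` and serves as the
  -- witness for `p`. Given `x` and its witness, `x + 1# + w` does both.
  Σ₁-∃ : {P : Env (suc n) → Set ℓ} → Σ₁-Definable P →
         Σ₁-Definable (λ ρ → Ex λ x → P (x ∷ ρ))
  Σ₁-∃ p = record
    { θ = ∃< W (θ p) ; δ = Arith.ex W (δ p)
    ; mono = λ {ρ} l h k → h λ x (x<w , q) →
        k x (W-intro {ρ = ρ} (<-≤-trans (W-elim {ρ = ρ} x<w) l) , mono p {x ∷ ρ} l q)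
    ; sound = λ w h k → h λ x (_ , q) → k x (sound p w q)
    ; complete = λ {ρ} h → some h >>= λ (x , q) → complete p q >>= λ (w , q′) →
        pure (x + 1# + w , λ k → k x
          (W-intro {ρ = ρ} (<-≤-trans m<m+1 m≤m+n) , mono p {x ∷ ρ} m≤n+m q′)) }

  Σ₁-Σ₁ : {φ : Formula 𝓛A n} → Arith.Σ₁ φ → Σ₁-Definable (λ ρ → Sat M ρ φ)
  Σ₁-Σ₁ (Arith.bounded d) = Σ₁-Δ₀ d
  Σ₁-Σ₁ (Arith.exists s)  = Σ₁-∃ (Σ₁-Σ₁ s)

  -- Collection puts witnesses for all `x < a` below one `b`, and `mono` raises each of them to `b`
  -- itself.
  collect : {P : Env (suc n) → Set ℓ} (p : Σ₁-Definable P) → ∀ {ρ a} →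
            (∀ x → x < a → P (x ∷ ρ)) →
            ¬ ¬ (Σ[ w ∈ Carrier ] ∀ x → x < a → Sat M (x ∷ (ρ ∷ʳ w)) (θ p))
  collect {n} p {ρ} {a} h =
    some (Σ₁-collection (Arith.bounded (Δ₀-[] (δ p) σ)) {ρ} {a}
            (λ x x<a → exists (complete p (h x x<a) >>= λ (w , q) →
               pure (w , from eqv q))))
      >>= λ (b , k) → pure (b , λ x x<a → Sat-stable (θ p)
        (some (k x x<a) >>= λ (w , w<b , q) →
          pure (mono p {x ∷ ρ} (<⇒≤ w<b) (to eqv q))))
    where
    us : Vec (Term 𝓛A (suc (suc n))) n
    us = params 2
    σ : Vec (Term 𝓛A (suc (suc n))) (suc (suc n))
    -- The collection scheme puts the witness first, whereas `θ` has it last.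
    σ = v1 ∷ (us ∷ʳ v0)
    eqv : ∀ {x w} → Sat M (w ∷ x ∷ ρ) (θ p [ σ ]) ⇔ Sat M (x ∷ (ρ ∷ʳ w)) (θ p)
    eqv {x} {w} = Sat-subst-≡ (θ p) σ (cong (x ∷_)
      (trans (evals-∷ʳ us v0) (cong (_∷ʳ w) (evals-params (w ∷ x ∷ [])))))

  -- By `collect`, one witness serves all `x` below the bound, so the witness quantifier moves
  -- outside the bounded one.
  Σ₁-∀< : {P : Env (suc n) → Set ℓ} (t : Term 𝓛A n) → Σ₁-Definable P →
          Σ₁-Definable (λ ρ → ∀ x → x < eval M ρ t → P (x ∷ ρ))
  Σ₁-∀< {n} t p = record
    { θ = ∀< t′ (θ p) ; δ = Arith.all t′ (δ p)
    ; mono = λ {ρ} l h x x<t → mono p {x ∷ ρ} l (h x (move ρ x<t))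
    ; sound = λ {ρ} w h x x<t → sound p w (h x (subst (x <_) (sym (eqn ρ)) x<t))
    ; complete = λ {ρ} h → collect p h >>= λ (w , k) →
        pure (w , λ x x<t → k x (subst (x <_) (eqn ρ) x<t)) }
    where
    t′ : Term 𝓛A (suc n)
    t′ = rename inject₁ t
    eqn : ∀ ρ {x w} → eval M (x ∷ (ρ ∷ʳ w)) (↑ t′) ≡ eval M ρ t
    eqn ρ = trans (eval-↑ t′) (eval-rename (lookup-∷ʳ-inject₁ ρ) t)
    move : ∀ ρ {x w w′} → x < eval M (x ∷ (ρ ∷ʳ w′)) (↑ t′) →
           x < eval M (x ∷ (ρ ∷ʳ w)) (↑ t′)
    move ρ {x} = subst (x <_) (trans (eqn ρ) (sym (eqn ρ)))

  -- Applying `collect` to the disjunction of `P` and its negation below `x + 1#` gives a `w` that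
  -- decides `P` there: at each `y ≤ x`, `P` is equivalent to the bounded formula `θ p` at this `w`.
  -- So `Δ₀-induction` applies, with `x` and `w` as parameters.
  Δ₁-induction : {P : Env (suc n) → Set ℓ} → (∀ {ρ} → Stable (P ρ)) →
                 Σ₁-Definable P → Σ₁-Definable (¬_ ∘ P) → ∀ {ρ} →
                 P (0# ∷ ρ) → (∀ x → P (x ∷ ρ) → P (x + 1# ∷ ρ)) →
                 ∀ x → P (x ∷ ρ)
  Δ₁-induction {n} {P} P-stable p q {ρ} base step x = P-stable
    (collect (Σ₁-∨ p q) {ρ} {x + 1#} (λ y _ → lem _) >>= λ (w , h) →
      let
        σ : Vec (Term 𝓛A (suc (suc (suc n)))) (suc (suc n))
        -- The parameter `x` sits right after the induction variable, and `θ p` has to skip it.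
        σ = v0 ∷ params 2
        eqv : ∀ {y} → Sat M (y ∷ x ∷ (ρ ∷ʳ w)) (θ p [ σ ]) ⇔ Sat M (y ∷ (ρ ∷ʳ w)) (θ p)
        eqv {y} = Sat-subst-≡ (θ p) σ (cong (y ∷_) (evals-params (y ∷ x ∷ [])))
        decide : ∀ y → y < x + 1# → P (y ∷ ρ) → Sat M (y ∷ (ρ ∷ʳ w)) (θ p)
        decide y y<x+1 r = Sat-stable (θ p) (cases (h y y<x+1) >>= λ where
          (inj₁ s) → pure s
          (inj₂ s) → contradiction r (sound q w s))
        bounded-P = Δ₀-induction
          -- The guard restricts the claim to `y < x + 1#`, where `w` is known to decide `P`.
          (Arith.imp (Arith.atom lessS (v0 ∷ v1 +̇ 1̇ ∷ [])) (Δ₀-[] (δ p) σ))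
          {x ∷ (ρ ∷ʳ w)}
          (λ 0<x+1 → from eqv (decide 0# 0<x+1 base))
          (λ y r y+1<x+1 → from eqv (decide (y + 1#) y+1<x+1
            (step y (sound p w (to eqv (r (<-trans m<m+1 y+1<x+1)))))))
      in pure (sound p w (to eqv (bounded-P x m<m+1))))

-- Exponentiation

pattern v4 = var (suc (suc (suc (suc zero))))
pattern v5 = var (suc (suc (suc (suc (suc zero)))))

modulus : (b i : Term 𝓛A n) → Term 𝓛A n
modulus b i = 1̇ +̇ (i +̇ 1̇) *̇ b

Δ₀-Beta : (a b i r : Term 𝓛A n) → Δ₀ (Beta a b i r)
Δ₀-Beta a b i r = Arith.and (Arith.atom lessS _)
  (Arith.ex (a +̇ 1̇) (Arith.eq (↑ a) (v0 *̇ ↑ modulus b i +̇ ↑ r)))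

Σ₁-PowerOfTwo : (x y : Term 𝓛A n) → Arith.Σ₁ (PowerOfTwo x y)
Σ₁-PowerOfTwo x y = Arith.exists (Arith.exists (Arith.bounded
  (Arith.and (Δ₀-Beta v1 v0 0̇ 1̇)
  (Arith.and (Arith.all (↑ ↑ x) (Arith.ex (v2 +̇ 1̇)
                (Arith.and (Δ₀-Beta v3 v2 v1 v0)
                           (Δ₀-Beta v3 v2 (v1 +̇ 1̇) (v0 +̇ v0)))))
             (Δ₀-Beta v1 v0 (↑ ↑ x) (↑ ↑ y))))))

-- y = (2q + 1) p + r with r < p: the digit of y at the power of two p is 1.
OddBlock : (p y : Term 𝓛A n) → Formula 𝓛A n
OddBlock p y = ∃< (y +̇ 1̇) (∃< (↑ p) (↑ ↑ y ≐ (v1 +̇ v1 +̇ 1̇) *̇ ↑ ↑ p +̇ v0))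

Δ₀-OddBlock : (p y : Term 𝓛A n) → Δ₀ (OddBlock p y)
Δ₀-OddBlock p y = Arith.ex (y +̇ 1̇) (Arith.ex (↑ p) (Arith.eq _ _))

Member : (x y : Term 𝓛A n) → Formula 𝓛A n
Member x y = ∃̇ (PowerOfTwo (↑ x) v0 ∧̇ OddBlock v0 (↑ y))

module Exponential (M : Structure 𝓛A ℓ) (M⊨BΣ₁+exp : M ⊨ BΣ₁ ∪ ｛ exp ｝) where
  open Collection M (λ φ h → M⊨BΣ₁+exp φ (inj₁ h)) public

  β : (a b i r : Carrier) → Set ℓ
  β a b i r = Sat M (a ∷ b ∷ i ∷ r ∷ []) (Beta v0 v1 v2 v3)

  Pow : (x p : Carrier) → Set ℓ
  Pow x p = Sat M (x ∷ p ∷ []) (PowerOfTwo v0 v1)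

  Bit : (p y : Carrier) → Set ℓ
  Bit p y = Sat M (p ∷ y ∷ []) (OddBlock v0 v1)

  Mem : (x y : Carrier) → Set ℓ
  Mem x y = Sat M (x ∷ y ∷ []) (Member v0 v1)

  private
    variable
      i p q r s x x′ y y′ : Carrier

  record PowCode (a b x y : Carrier) : Set ℓ where
    field
      start : β a b 0# 1#
      next  : ∀ i → i < x → Ex λ z → z < a + 1# × β a b i z × β a b (i + 1#) (z + z)
      end   : β a b x y

  open PowCode

  decode : Pow x y → ¬ ¬ (Σ[ a ∈ Carrier ] Σ[ b ∈ Carrier ] PowCode a b x y)
  decode h = some h >>= λ (a , h′) → some h′ >>= λ (b , s , n , e) →
    pure (a , b , record { start = s ; next = n ; end = e })

  encode : ∀ {a b} → PowCode a b x y → Pow x y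
  encode c h = h _ λ k → k _ (start c , next c , end c)

  Pow-stable : Stable (Pow x y)
  Pow-stable {x} {y} = Sat-stable (PowerOfTwo v0 v1) {x ∷ y ∷ []}

  Mem-stable : Stable (Mem x y)
  Mem-stable {x} {y} = Sat-stable (Member v0 v1) {x ∷ y ∷ []}

  β-stable : ∀ {a b i r} → Stable (β a b i r)
  β-stable {a} {b} {i} {r} = Sat-stable (Beta v0 v1 v2 v3) {a ∷ b ∷ i ∷ r ∷ []}

  Pow-resp : x ≈ x′ → y ≈ y′ → Pow x y → Pow x′ y′
  Pow-resp e f = Sat-resp (PowerOfTwo v0 v1) (e ∷ f ∷ [])

  Mem-resp : x ≈ x′ → y ≈ y′ → Mem x y → Mem x′ y′
  Mem-resp e f = Sat-resp (Member v0 v1) (e ∷ f ∷ [])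

  Bit-resp : x ≈ x′ → y ≈ y′ → Bit x y → Bit x′ y′
  Bit-resp e f = Sat-resp (OddBlock v0 v1) (e ∷ f ∷ [])

  β-resp : ∀ {a b i i′ r r′} → i ≈ i′ → r ≈ r′ → β a b i r → β a b i′ r′
  β-resp e f = Sat-resp (Beta v0 v1 v2 v3) (≈-refl ∷ ≈-refl ∷ e ∷ f ∷ [])

  β-functional : ∀ {a b i r r′} → β a b i r → β a b i r′ → r ≈ r′
  β-functional (r<m , h) (r′<m , h′) = ≈-stable _ _
    (some h >>= λ (q , _ , e) → some h′ >>= λ (q′ , _ , e′) →
      pure (remainder-unique r<m r′<m (≈-trans (≈-sym e) e′)))

  -- A remainder is at most the dividend `a`. This lets `Pow-functional` quantify over the entries
  -- of a code below `a + 1#`, which keeps its induction formula bounded.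
  β-bound : ∀ {a b i r} → β a b i r → r < a + 1#
  β-bound (_ , h) = <-stable (some h >>= λ (q , _ , e) →
    pure (≤⇒<+1 (≤-respʳ (≈-sym e) m≤n+m)))

  -- With two codes as parameters, Δ₀ induction on the index shows that an entry of the first is
  -- also the entry of the second at that index. In the step, both entries are doubles of entries
  -- that agree.
  Pow-functional : Pow x y → Pow x y′ → y ≈ y′
  Pow-functional {x} {y} {y′} h h′ = ≈-stable _ _
    (decode h >>= λ (a , b , c) → decode h′ >>= λ (a′ , b′ , c′) →
    let
      agree = Δ₀-induction
        {φ = v0 <̇ v5 +̇ 1̇ ⇒̇ ∀< (v1 +̇ 1̇) (Beta v2 v3 v1 v0 ⇒̇ Beta v4 v5 v1 v0)}
        (Arith.imp (Arith.atom lessS _)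
          (Arith.all _ (Arith.imp (Δ₀-Beta v2 v3 v1 v0) (Δ₀-Beta v4 v5 v1 v0))))
        {a ∷ b ∷ a′ ∷ b′ ∷ x ∷ []}
        (λ _ z _ k → β-resp ≈-refl (β-functional (start c) k) (start c′))
        (λ i IH i+1<x+1 z _ k → β-stable (
          let i<x = <-≤-trans m<m+1 (<+1⇒≤ i+1<x+1) in
          some (next c i i<x) >>= λ (u , u<a+1 , u₀ , u₁) →
          some (next c′ i i<x) >>= λ (u′ , _ , u′₀ , u′₁) →
          let u≈u′ = β-functional (IH (<-trans m<m+1 i+1<x+1) u u<a+1 u₀) u′₀ in
          pure (β-resp ≈-refl
            (≈-trans (≈-sym (+-cong u≈u′ u≈u′)) (β-functional u₁ k)) u′₁)))
    in pure (β-functional (agree x m<m+1 y (β-bound (end c)) (end c)) (end c′)))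

  Pow-total : ∀ x → ¬ ¬ (Σ[ p ∈ Carrier ] Pow x p)
  Pow-total x = some (M⊨BΣ₁+exp _ (inj₂ refl) x)

  -- No code is constructed: `exp` supplies one for the exponent `0#`, and its `start` and `end`
  -- concern the same entry.
  Pow-zero : Pow 0# 1#
  Pow-zero = Pow-stable (Pow-total 0# >>= λ (p , h) →
    decode h >>= λ (a , b , c) →
    pure (Pow-resp ≈-refl (β-functional (end c) (start c)) h))

  -- No code is extended: `exp` supplies one for `x + 1#`, and the same `a` and `b`, read only up to
  -- `x`, code a power of `x`. By functionality that power is `p`.
  Pow-suc : Pow x p → Pow (x + 1#) (p + p)
  Pow-suc {x} {p} h = Pow-stable
    (Pow-total (x + 1#) >>= λ (s , k) → decode k >>= λ (a , b , c) →
    some (next c x m<m+1) >>= λ (p′ , _ , e₀ , e₁) →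
    let p≈p′ = Pow-functional h (encode record
                 { start = start c
                 ; next  = λ i i<x → next c i (<-trans i<x m<m+1)
                 ; end   = e₀ })
    in pure (Pow-resp ≈-refl
         (≈-trans (β-functional (end c) e₁) (≈-sym (+-cong p≈p′ p≈p′))) k))

-- Bounded formulas with exponentiation

infixr 7 _and_
infixr 5 _imp_

-- A deep embedding, so that one induction on syntax shows all these formulas to be Δ₁. Powers and
-- membership count as atoms although their arithmetical definitions have unbounded quantifiers.
data ExpFormula (n : ℕ) : Set where
  equal less   : Term 𝓛A n → Term 𝓛A n → ExpFormula n
  power member : Fin n → Fin n → ExpFormula n
  not          : ExpFormula n → ExpFormula n
  _and_ _imp_  : ExpFormula n → ExpFormula n → ExpFormula n
  all          : Term 𝓛A n → ExpFormula (suc n) → ExpFormula n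

ex : Term 𝓛A n → ExpFormula (suc n) → ExpFormula n
ex t φ = not (all t (not φ))

_or_ : ExpFormula n → ExpFormula n → ExpFormula n
φ or ψ = not (not φ and not ψ)

ren : (Fin m → Fin n) → ExpFormula m → ExpFormula n
ren f (equal s t)  = equal (rename f s) (rename f t)
ren f (less s t)   = less (rename f s) (rename f t)
ren f (power i j)  = power (f i) (f j)
ren f (member i j) = member (f i) (f j)
ren f (not φ)      = not (ren f φ)
ren f (φ and ψ)    = ren f φ and ren f ψ
ren f (φ imp ψ)    = ren f φ imp ren f ψ
ren f (all t φ)    = all (rename f t) (ren (lift 1 f) φ)

module ExpFormulas (M : Structure 𝓛A ℓ) (M⊨BΣ₁+exp : M ⊨ BΣ₁ ∪ ｛ exp ｝) where
  open Exponential M M⊨BΣ₁+exp public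
  open Equivalence

  ⟦_⟧ : ExpFormula n → Env n → Set ℓ
  ⟦ equal s t ⟧  ρ = eval M ρ s ≈ eval M ρ t
  ⟦ less s t ⟧   ρ = eval M ρ s < eval M ρ t
  ⟦ power i j ⟧  ρ = Pow (lookup ρ i) (lookup ρ j)
  ⟦ member i j ⟧ ρ = Mem (lookup ρ i) (lookup ρ j)
  ⟦ not φ ⟧      ρ = ¬ ⟦ φ ⟧ ρ
  ⟦ φ and ψ ⟧    ρ = ⟦ φ ⟧ ρ × ⟦ ψ ⟧ ρ
  ⟦ φ imp ψ ⟧    ρ = ⟦ φ ⟧ ρ → ⟦ ψ ⟧ ρ
  ⟦ all t φ ⟧    ρ = ∀ x → x < eval M ρ t → ⟦ φ ⟧ (x ∷ ρ)

  some< : ∀ {t} {P : Carrier → Set ℓ} → ¬ (∀ x → x < t → ¬ P x) →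
          ¬ ¬ (Σ[ x ∈ Carrier ] x < t × P x)
  some< h k = h λ x l p → k (x , l , p)

  ⟦⟧-stable : ∀ (φ : ExpFormula n) {ρ} → Stable (⟦ φ ⟧ ρ)
  ⟦⟧-stable (equal s t)  = ≈-stable _ _
  ⟦⟧-stable (less s t)   = <-stable
  ⟦⟧-stable (power i j)  = Pow-stable
  ⟦⟧-stable (member i j) = Mem-stable
  ⟦⟧-stable (not φ)      = negated-stable
  ⟦⟧-stable (φ and ψ)    h =
    ⟦⟧-stable φ (h >>= pure ∘ proj₁) , ⟦⟧-stable ψ (h >>= pure ∘ proj₂)
  ⟦⟧-stable (φ imp ψ)    h x = ⟦⟧-stable ψ (h >>= λ f → pure (f x))
  ⟦⟧-stable (all t φ)    h x l = ⟦⟧-stable φ (h >>= λ f → pure (f x l))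

  ⟦⟧-resp : ∀ (φ : ExpFormula n) {ρ ρ′} → Pointwise _≈_ ρ ρ′ → ⟦ φ ⟧ ρ → ⟦ φ ⟧ ρ′
  ⟦⟧-resp (equal s t)  e h =
    ≈-trans (≈-sym (eval-resp e s)) (≈-trans h (eval-resp e t))
  ⟦⟧-resp (less s t)   e h = <-resp (eval-resp e s) (eval-resp e t) h
  ⟦⟧-resp (power i j)  e h = Pow-resp (Pointwise.lookup e i) (Pointwise.lookup e j) h
  ⟦⟧-resp (member i j) e h = Mem-resp (Pointwise.lookup e i) (Pointwise.lookup e j) h
  ⟦⟧-resp (not φ)      e h k = h (⟦⟧-resp φ (Pointwise.sym ≈-sym e) k)
  ⟦⟧-resp (φ and ψ)    e (h , k) = ⟦⟧-resp φ e h , ⟦⟧-resp ψ e k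
  ⟦⟧-resp (φ imp ψ)    e h k = ⟦⟧-resp ψ e (h (⟦⟧-resp φ (Pointwise.sym ≈-sym e) k))
  ⟦⟧-resp (all t φ)    e h x l =
    ⟦⟧-resp φ (≈-refl ∷ e) (h x (<-respʳ (≈-sym (eval-resp e t)) l))

  ⟦ren⟧ : ∀ (φ : ExpFormula m) {f : Fin m → Fin n} {ρ ρ′} →
          (∀ i → lookup ρ′ (f i) ≡ lookup ρ i) → ⟦ ren f φ ⟧ ρ′ ⇔ ⟦ φ ⟧ ρ
  ⟦ren⟧ (equal s t)  {f} {ρ} {ρ′} e
    rewrite eval-rename {f = f} {ρ} {ρ′} e s | eval-rename {f = f} {ρ} {ρ′} e t = mk⇔ id id
  ⟦ren⟧ (less s t)   {f} {ρ} {ρ′} e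
    rewrite eval-rename {f = f} {ρ} {ρ′} e s | eval-rename {f = f} {ρ} {ρ′} e t = mk⇔ id id
  ⟦ren⟧ (power i j)  e rewrite e i | e j = mk⇔ id id
  ⟦ren⟧ (member i j) e rewrite e i | e j = mk⇔ id id
  ⟦ren⟧ (not φ)      e = mk⇔ (_∘ from (⟦ren⟧ φ e)) (_∘ to (⟦ren⟧ φ e))
  ⟦ren⟧ (φ and ψ)    e = mk⇔
    (λ (h , k) → to (⟦ren⟧ φ e) h , to (⟦ren⟧ ψ e) k)
    (λ (h , k) → from (⟦ren⟧ φ e) h , from (⟦ren⟧ ψ e) k)
  ⟦ren⟧ (φ imp ψ)    e = mk⇔
    (λ h k → to (⟦ren⟧ ψ e) (h (from (⟦ren⟧ φ e) k)))
    (λ h k → from (⟦ren⟧ ψ e) (h (to (⟦ren⟧ φ e) k)))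
  ⟦ren⟧ (all t φ) {f} {ρ} {ρ′} e rewrite eval-rename {f = f} {ρ} {ρ′} e t = mk⇔
    (λ h x l → to (⟦ren⟧ φ e′) (h x l))
    (λ h x l → from (⟦ren⟧ φ e′) (h x l))
    where
    e′ : ∀ {x} i → lookup (x ∷ ρ′) (lift 1 f i) ≡ lookup (x ∷ ρ) i
    e′ zero    = refl
    e′ (suc i) = e i

  Σ₁-¬Δ₀ : {φ : Formula 𝓛A n} → Δ₀ φ → Σ₁-Definable (λ ρ → ¬ Sat M ρ φ)
  Σ₁-¬Δ₀ d = Σ₁-resp refute (λ h → pure λ x → contradiction x h)
                     (Σ₁-Δ₀ (Arith.imp d Arith.fls))

  mutual
    -- Proved together with the negated version, since `not` exchanges the two. A bounded universal
    -- quantifier goes through `Σ₁-∀<`, hence through collection; its negation is existential.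
    Σ₁-⟦_⟧ : ∀ (φ : ExpFormula n) → Σ₁-Definable ⟦ φ ⟧
    Σ₁-⟦ equal s t ⟧  = Σ₁-Δ₀ (Arith.eq s t)
    Σ₁-⟦ less s t ⟧   = Σ₁-Δ₀ (Arith.atom lessS (s ∷ t ∷ []))
    Σ₁-⟦ power i j ⟧  = Σ₁-Σ₁ (Σ₁-PowerOfTwo (var i) (var j))
    Σ₁-⟦ member i j ⟧ =
      Σ₁-∃ (Σ₁-∧ (Σ₁-Σ₁ (Σ₁-PowerOfTwo (var (suc i)) v0))
                  (Σ₁-Δ₀ (Δ₀-OddBlock v0 (var (suc j)))))
    Σ₁-⟦ not φ ⟧      = Σ₁-¬⟦ φ ⟧
    Σ₁-⟦ φ and ψ ⟧    = Σ₁-∧ Σ₁-⟦ φ ⟧ Σ₁-⟦ ψ ⟧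
    Σ₁-⟦ φ imp ψ ⟧    = Σ₁-resp
      (λ h x → ⟦⟧-stable ψ (h >>= λ where
        (inj₁ k) → contradiction x k
        (inj₂ k) → pure k))
      (λ {ρ} h → lem (⟦ φ ⟧ ρ) >>= λ where
        (inj₁ x) → pure (pure (inj₂ (h x)))
        (inj₂ x) → pure (pure (inj₁ x)))
      (Σ₁-∨ Σ₁-¬⟦ φ ⟧ Σ₁-⟦ ψ ⟧)
    Σ₁-⟦ all t φ ⟧    = Σ₁-∀< t Σ₁-⟦ φ ⟧

    Σ₁-¬⟦_⟧ : ∀ (φ : ExpFormula n) → Σ₁-Definable (¬_ ∘ ⟦ φ ⟧)
    Σ₁-¬⟦ equal s t ⟧  = Σ₁-¬Δ₀ (Arith.eq s t)
    Σ₁-¬⟦ less s t ⟧   = Σ₁-¬Δ₀ (Arith.atom lessS (s ∷ t ∷ []))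
    -- 2^x ≠ y means that 2^x = p for some p ≠ y; likewise for membership.
    Σ₁-¬⟦ power i j ⟧  = Σ₁-resp
      (λ h k → some h λ (p , k′ , p≉y) → p≉y (Pow-functional k′ k))
      (λ {ρ} h → Pow-total (lookup ρ i) >>= λ (p , k) →
        pure (exists (pure (p , k , λ e → h (Pow-resp ≈-refl e k)))))
      (Σ₁-∃ (Σ₁-∧ (Σ₁-Σ₁ (Σ₁-PowerOfTwo (var (suc i)) v0))
                   (Σ₁-¬Δ₀ (Arith.eq v0 (var (suc j))))))
    Σ₁-¬⟦ member i j ⟧ = Σ₁-resp
      (λ h k → some h λ (p , l , ¬b) → some k λ (p′ , l′ , b) →
        ¬b (Bit-resp (Pow-functional l′ l) ≈-refl b))
      (λ {ρ} h → Pow-total (lookup ρ i) >>= λ (p , k) →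
        pure (exists (pure (p , k , λ b → h (exists (pure (p , k , b)))))))
      (Σ₁-∃ (Σ₁-∧ (Σ₁-Σ₁ (Σ₁-PowerOfTwo (var (suc i)) v0))
                   (Σ₁-¬Δ₀ (Δ₀-OddBlock v0 (var (suc j))))))
    Σ₁-¬⟦ not φ ⟧      = Σ₁-resp pure id Σ₁-⟦ φ ⟧
    Σ₁-¬⟦ φ and ψ ⟧    = Σ₁-resp
      (λ h (x , y) → h λ where
        (inj₁ k) → k x
        (inj₂ k) → k y)
      (λ {ρ} h → lem (⟦ φ ⟧ ρ) >>= λ where
        (inj₁ x) → pure (pure (inj₂ λ y → h (x , y)))
        (inj₂ x) → pure (pure (inj₁ x)))
      (Σ₁-∨ Σ₁-¬⟦ φ ⟧ Σ₁-¬⟦ ψ ⟧)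
    Σ₁-¬⟦ φ imp ψ ⟧    = Σ₁-resp
      (λ (x , k) h → k (h x))
      (λ h → pure (⟦⟧-stable φ (λ k → h λ x → contradiction x k) , λ y → h λ _ → y))
      (Σ₁-∧ Σ₁-⟦ φ ⟧ Σ₁-¬⟦ ψ ⟧)
    Σ₁-¬⟦ all t φ ⟧    = Σ₁-resp
      (λ h k → some h λ (x , l , ¬φ) → ¬φ (k x (subst (x <_) (eval-↑ t) l)))
      (λ h → pure λ k → h λ x l → ⟦⟧-stable φ λ ¬φ →
        k x (subst (x <_) (sym (eval-↑ t)) l , ¬φ))
      (Σ₁-∃ (Σ₁-∧ (Σ₁-Δ₀ (Arith.atom lessS (v0 ∷ ↑ t ∷ []))) Σ₁-¬⟦ φ ⟧))

  induction : ∀ (φ : ExpFormula (suc n)) {ρ} →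
              ⟦ φ ⟧ (0# ∷ ρ) → (∀ x → ⟦ φ ⟧ (x ∷ ρ) → ⟦ φ ⟧ (x + 1# ∷ ρ)) →
              ∀ x → ⟦ φ ⟧ (x ∷ ρ)
  induction φ = Δ₁-induction (⟦⟧-stable φ) Σ₁-⟦ φ ⟧ Σ₁-¬⟦ φ ⟧

-- Binary digits

module Bits (M : Structure 𝓛A ℓ) (M⊨BΣ₁+exp : M ⊨ BΣ₁ ∪ ｛ exp ｝) where
  open ExpFormulas M M⊨BΣ₁+exp public
  open Solve using (solve; _:=_; _:+_; _:*_; con)
  open Equivalence

  private
    variable
      c i p q r s x y z : Carrier

  -- The step is `x + 1# ≤ q < q + q`. Induction needs a bounded formula, so the power ranges below
  -- a fixed parameter; `p + 1#` suffices, as the powers met on the way are no larger than `p`. The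
  -- same device recurs below.
  n<2^n : Pow x p → x < p
  n<2^n {x} {p} h = induction
    (all v1 (power (# 1) (# 0) imp less v1 v0)) {p + 1# ∷ []}
    (λ p _ h → <-respʳ (Pow-functional Pow-zero h) 0<1)
    (λ x IH p p<A h → <-stable (Pow-total x >>= λ (q , k) →
      let e = Pow-functional (Pow-suc k) h
          q≤p = ≤-respʳ e m≤m+n
          x<q = IH q (≤-<-trans q≤p p<A) k
      in pure (<-respʳ e (≤-<-trans (<⇒+1≤ x<q) (m<m+n (≤-<-trans 0≤ x<q))))))
    x p m<m+1 h

  0<2^n : Pow x p → 0# < p
  0<2^n h = ≤-<-trans 0≤ (n<2^n h)

  -- By induction on `c`, the quotient is 1 for the successor of `i` and doubles from there on.
  -- Divisibility by `p + p`, not merely by `p`, is what keeps the digit at `i` unchanged when `s`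
  -- is added.
  2^1+i∣2^c : i < c → Pow i p → Pow c s → ¬ ¬ (Σ[ k ∈ Carrier ] k * (p + p) ≈ s)
  2^1+i∣2^c {i} {c} {p} {s} i<c hp hs =
    some< (induction
      (all v3 (power (# 1) (# 0) imp less v2 v1 imp
        ex v4 (equal (v0 *̇ (v4 +̇ v4)) v1)))
      {i ∷ p ∷ s + 1# ∷ []}
      (λ s _ _ i<0 → contradiction i<0 0≤)
      (λ c IH s′ s′<A h i<c+1 → negated-stable (Pow-total c >>= λ (s , k) →
        let e = Pow-functional (Pow-suc k) h in
        ≤-split (<+1⇒≤ i<c+1) >>= λ where
          (inj₁ i<c) →
            some< (IH s (≤-<-trans (≤-respʳ e m≤m+n) s′<A) k i<c) >>= λ (d , _ , f) →
            let g = ≈-trans (distribʳ _ _ _) (≈-trans (+-cong f f) e) in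
            -- A quotient by a positive number is at most the dividend, so it respects the bound in
            -- the induction formula.
            pure λ n → n (d + d) (≤-<-trans (≤-respʳ g (m≤m*n 0<2p)) s′<A) g
          (inj₂ i≈c) →
            let p≈s = Pow-functional (Pow-resp i≈c ≈-refl hp) k
                g = ≈-trans (*-identityˡ _) (≈-trans (+-cong p≈s p≈s) e) in
            pure λ n → n 1# (≤-<-trans (≤-respʳ g (m≤m*n 0<2p)) s′<A) g))
      c s m<m+1 hs i<c)
    >>= λ (k , _ , e) → pure (k , e)
    where
    0<2p = <-≤-trans (0<2^n hp) m≤m+n

  -- `s` is a multiple `k * (p + p)`, and `k` is nonzero because `s` is positive.
  2^-mono-< : i < c → Pow i p → Pow c s → p < s
  2^-mono-< i<c hp hs = <-stable (2^1+i∣2^c i<c hp hs >>= λ (k , e) →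
    lem (0# < k) >>= λ where
      (inj₁ 0<k) → pure (<-≤-trans (m<m+n (0<2^n hp))
                     (≤-respʳ (≈-trans (*-comm _ _) e) (m≤m*n 0<k)))
      (inj₂ k≤0) → contradiction (≈-trans (≈-sym (zeroˡ _))
                     (≈-trans (*-congʳ (≤-antisym 0≤ k≤0)) e)) (<⇒≉ (0<2^n hs)))

  -- Digits of numbers and of sums

  Bit-elim : Bit p y →
             ¬ ¬ (Σ[ q ∈ Carrier ] Σ[ r ∈ Carrier ] r < p × y ≈ (q + q + 1#) * p + r)
  Bit-elim h = some h >>= λ (q , _ , h′) → some h′ >>= λ (r , r<p , e) →
    pure (q , r , r<p , e)

  Bit-intro : r < p → y ≈ (q + q + 1#) * p + r → Bit p y
  Bit-intro {r} {p} {y} {q} r<p e n = n q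
    ( ≤⇒<+1 (≤-respʳ (≈-sym e)
        (≤-trans (≤-trans m≤m+n (≤-trans m≤m+n (m≤m*n (≤-<-trans 0≤ r<p)))) m≤m+n))
    , λ k → k r (r<p , e))

  Bit⇒≤ : Bit p y → p ≤ y
  Bit⇒≤ h y<p = Bit-elim h λ (q , r , _ , e) →
    ≤-trans (≤-respˡ (*-identityˡ _) (*-monoˡ-≤ m≤n+m)) m≤m+n (<-respˡ e y<p)

  -- The summand turns the odd quotient `2q + 1` into the odd quotient `2(k + q) + 1` and keeps the
  -- remainder.
  Bit-+ : ∀ {k} → Bit p z → Bit p (k * (p + p) + z)
  Bit-+ {p} {z} {k} h = Sat-stable (OddBlock v0 v1) {p ∷ k * (p + p) + z ∷ []}
    (Bit-elim h >>= λ (q , r , r<p , e) → pure (Bit-intro {q = k + q} r<p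
      (≈-trans (+-congˡ e)
        (solve 4 (λ k p q r → k :* (p :+ p) :+ ((q :+ q :+ con 1) :* p :+ r)
           := ((k :+ q) :+ (k :+ q) :+ con 1) :* p :+ r) ≈-refl k p q r))))

  Bit-+⁻ : ∀ {k} → Bit p (k * (p + p) + z) → Bit p z
  Bit-+⁻ {p} {z} {k} h = Sat-stable (OddBlock v0 v1) {p ∷ z ∷ []}
    (Bit-elim h >>= λ (q , r , r<p , e) → compare q k >>= λ where
      -- Here `(2q + 1)p + r` is below `(q + 1)2p`, hence below `k * (p + p) + z`.
      (inj₁ q<k) → contradiction
        (<-≤-trans
          (<-respʳ
            (solve 2 (λ p q → (q :+ q :+ con 1) :* p :+ p
               := (q :+ con 1) :* (p :+ p)) ≈-refl p q)
            (+-monoʳ-< r<p))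
          (≤-trans (*-monoˡ-≤ (<⇒+1≤ q<k)) m≤m+n))
        (≤-reflexive e)
      (inj₂ k≤q) → ≤-diff k≤q >>= λ (d , f) → pure (Bit-intro {q = d} r<p
        (+-cancelˡ-≈ (≈-trans e
          (≈-trans (+-congʳ (*-congʳ (+-congʳ (+-cong (≈-sym f) (≈-sym f)))))
            (solve 4 (λ k p d r → ((k :+ d) :+ (k :+ d) :+ con 1) :* p :+ r
               := k :* (p :+ p) :+ ((d :+ d :+ con 1) :* p :+ r)) ≈-refl k p d r))))))

  Mem-elim : Mem x y → ¬ ¬ (Σ[ p ∈ Carrier ] Pow x p × Bit p y)
  Mem-elim = some

  Mem-intro : Pow x p → Bit p y → Mem x y
  Mem-intro h b n = n _ (h , b)

  Mem⇒2^x≤y : Mem x y → Pow x p → p ≤ y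
  Mem⇒2^x≤y h k y<p = Mem-elim h λ (q , l , b) →
    Bit⇒≤ b (<-respʳ (Pow-functional k l) y<p)

  -- From `x < 2^x ≤ y`. This turns quantifiers bounded by membership into quantifiers bounded by
  -- `<`, and foundation into induction.
  Mem⇒< : Mem x y → x < y
  Mem⇒< h = <-stable (Pow-total _ >>= λ (p , k) →
    pure (<-≤-trans (n<2^n k) (Mem⇒2^x≤y h k)))

  Mem-+ : i < c → Pow c s → Mem i z → Mem i (s + z)
  Mem-+ i<c hs h = Mem-stable (Mem-elim h >>= λ (p , hp , b) →
    2^1+i∣2^c i<c hp hs >>= λ (k , e) →
    pure (Mem-resp ≈-refl (+-congʳ e) (Mem-intro hp (Bit-+ b))))

  Mem-+⁻ : i < c → Pow c s → Mem i (s + z) → Mem i z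
  Mem-+⁻ i<c hs h = Mem-stable (Mem-elim h >>= λ (p , hp , b) →
    2^1+i∣2^c i<c hp hs >>= λ (k , e) →
    pure (Mem-intro hp (Bit-+⁻ {k = k} (Bit-resp ≈-refl (+-congʳ (≈-sym e)) b))))

  Mem-top : Pow c s → z < s → Mem c (s + z)
  Mem-top {s = s} {z} hs z<s = Mem-intro hs (Bit-intro {q = 0#} z<s
    (solve 2 (λ s z → s :+ z := (con 0 :+ con 0 :+ con 1) :* s :+ z) ≈-refl s z))

  -- Otherwise `s ≤ 2^x ≤ y`.
  Mem⇒<-exponent : Pow c s → y < s → Mem x y → x < c
  Mem⇒<-exponent {c} hs y<s h = <-stable (Pow-total _ >>= λ (p , hp) → tri _ c >>= λ where
    (inj₁ x<c)        → pure x<c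
    (inj₂ (inj₁ x≈c)) → contradiction
      (<-respʳ (Pow-functional hs (Pow-resp x≈c ≈-refl hp)) y<s) (Mem⇒2^x≤y h hp)
    (inj₂ (inj₂ c<x)) → contradiction
      (<-trans y<s (2^-mono-< c<x hs hp)) (Mem⇒2^x≤y h hp))

  -- The code is built digit by digit. By induction on `c`, some `y` below the power `s` of `c` has
  -- the right digits at all places below `c`; the step adds `s` if `φ` holds of `c`. At `c = a`,
  -- the inequality `y < A` excludes any further digit.
  comprehension : ∀ (φ : ExpFormula (suc n)) ρ a → ¬ ¬ (Σ[ y ∈ Carrier ]
                  (∀ x → Mem x y ⇔ (x < a × ⟦ φ ⟧ (x ∷ ρ))))
  comprehension {n} φ ρ a = Pow-total a >>= λ (A , hA) →
    some< (induction
      (all (v1 +̇ 1̇) (power (# 1) (# 0) imp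
        ex v0 (all v2 digit⇔φ)))
      {A ∷ ρ}
      (λ s _ hs → λ n → n 0# (<-respʳ (Pow-functional Pow-zero hs) 0<1)
        λ x x<0 → contradiction x<0 0≤)
      (λ c IH s′ s′<A+1 hs′ → negated-stable (Pow-total c >>= λ (s , hs) →
        let e = Pow-functional (Pow-suc hs) hs′
            s≤s′ = ≤-respʳ e m≤m+n in
        some< (IH s (≤-<-trans s≤s′ s′<A+1) hs) >>= λ (y , y<s , hy) →
        lem (⟦ φ ⟧ (c ∷ ρ)) >>= λ where
          (inj₁ φc) → pure λ n → n (s + y) (<-respʳ e (+-monoʳ-< y<s)) λ x x<c+1 →
            ⟦⟧-stable digit⇔φ {x ∷ s + y ∷ s′ ∷ c + 1# ∷ A ∷ ρ}
            (≤-split (<+1⇒≤ x<c+1) >>= λ where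
              (inj₁ x<c) → pure
                -- Composing `to fφ` with `from fφ` moves `φ` between the environments of the
                -- induction hypothesis and of the goal, which differ in `y`, `s` and `c`.
                ( (λ h → from fφ (to fφ (proj₁ (hy x x<c) (Mem-+⁻ x<c hs h))))
                , (λ h → Mem-+ x<c hs (proj₂ (hy x x<c) (from fφ (to fφ h)))))
              (inj₂ x≈c) → pure
                ( (λ _ → from fφ (⟦⟧-resp φ (≈-sym x≈c ∷ Pointwise.refl ≈-refl) φc))
                , (λ _ → Mem-resp (≈-sym x≈c) ≈-refl (Mem-top hs y<s))))
          (inj₂ ¬φc) → pure λ n → n y (<-≤-trans y<s s≤s′) λ x x<c+1 →
            ⟦⟧-stable digit⇔φ {x ∷ y ∷ s′ ∷ c + 1# ∷ A ∷ ρ}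
            (≤-split (<+1⇒≤ x<c+1) >>= λ where
              (inj₁ x<c) → pure
                ( (λ h → from fφ (to fφ (proj₁ (hy x x<c) h)))
                , (λ h → proj₂ (hy x x<c) (from fφ (to fφ h))))
              (inj₂ x≈c) → pure
                ( (λ h → contradiction (Mem⇒<-exponent hs y<s h) (≤-reflexive (≈-sym x≈c)))
                , (λ h → contradiction
                    (⟦⟧-resp φ (x≈c ∷ Pointwise.refl ≈-refl) (to fφ h)) ¬φc)))))
      a A m<m+1 hA)
    >>= λ (y , y<A , hy) → pure (y , λ x → mk⇔
      (λ h → let x<a = Mem⇒<-exponent hA y<A h in x<a , to fφ (proj₁ (hy x x<a) h))
      (λ (x<a , h) → proj₂ (hy x x<a) (from fφ h)))
    where
    f : Fin (suc n) → Fin (5 +ℕ n)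
    f = lift 1 (4 ↑ʳ_)
    digit⇔φ : ExpFormula (5 +ℕ n)
    digit⇔φ = (member (# 0) (# 1) imp ren f φ) and (ren f φ imp member (# 0) (# 1))
    fφ : ∀ {x y s c A} → ⟦ ren f φ ⟧ (x ∷ y ∷ s ∷ c ∷ A ∷ ρ) ⇔ ⟦ φ ⟧ (x ∷ ρ)
    fφ = ⟦ren⟧ φ λ { zero → refl ; (suc i) → refl }

  -- Induction on a `c` whose power `s` exceeds both numbers, comparing their digits at the top
  -- place. If only `z` has the top digit, inclusion fails; if only `y` has it, `z < s ≤ y`; if both
  -- have it, `s` is subtracted from each. This yields extensionality and the bounds for sets of
  -- sets.
  ⊆⇒≤ : (∀ i → Mem i z → Mem i y) → z ≤ y
  -- The goal is a negation, so `y < z` may be assumed, and the power of two of `z` exceeds both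
  -- numbers.
  ⊆⇒≤ {z} {y} h y<z = Pow-total z λ (A , hA) →
    let z<A = n<2^n hA in
    induction
      (all v1 (all v2 (all (v3 +̇ 1̇) (power (# 3) (# 0) imp less v2 v0 imp less v1 v0 imp
        all v3 (member (# 0) (# 3) imp member (# 0) (# 2)) imp not (less v1 v2)))))
      {A ∷ []}
      (λ z _ y _ s _ hs z<s _ _ y<z → 0≤ (<-≤-trans y<z (<+1⇒≤ (<-respʳ
        (≈-trans (Pow-functional hs Pow-zero) (≈-sym (+-identityˡ _))) z<s))))
      (λ c IH z z<A y y<A s′ s′<A+1 hs′ z<s′ y<s′ h → negated-stable
        (Pow-total c >>= λ (s , hs) →
        let e = Pow-functional (Pow-suc hs) hs′
            s<A+1 = ≤-<-trans (≤-respʳ e m≤m+n) s′<A+1 in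
        compare y s >>= λ where
          (inj₁ y<s) → compare z s >>= λ where
            (inj₁ z<s) → pure (IH z z<A y y<A s s<A+1 hs z<s y<s
              λ i i<c → h i (<-trans i<c m<m+1))
            (inj₂ s≤z) → ≤-diff s≤z >>= λ (z′ , f) → contradiction
              (h c m<m+1 (Mem-resp ≈-refl f (Mem-top hs
                (+-cancelˡ-< (<-resp (≈-sym f) (≈-sym e) z<s′)))))
              (λ k → Mem⇒2^x≤y k hs y<s)
          (inj₂ s≤y) → compare z s >>= λ where
            (inj₁ z<s) → pure (<⇒≤ (<-≤-trans z<s s≤y))
            (inj₂ s≤z) → ≤-diff s≤z >>= λ (z′ , f) → ≤-diff s≤y >>= λ (y′ , g) →
              pure (≤-resp f g (+-monoʳ-≤ (IH
                z′ (≤-<-trans (≤-respʳ f m≤n+m) z<A)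
                y′ (≤-<-trans (≤-respʳ g m≤n+m) y<A)
                s s<A+1 hs
                (+-cancelˡ-< (<-resp (≈-sym f) (≈-sym e) z<s′))
                (+-cancelˡ-< (<-resp (≈-sym g) (≈-sym e) y<s′))
                λ i i<c k → Mem-+⁻ i<c hs (Mem-resp ≈-refl (≈-sym g)
                  (h i (<-trans i<c m<m+1) (Mem-resp ≈-refl f (Mem-+ i<c hs k)))))))))
      z z z<A y (<-trans y<z z<A) A m<m+1 hA z<A (<-trans y<z z<A) (λ i _ → h i) y<z

-- The set-theoretic structure

isSingleton : (s u : Fin n) → ExpFormula n
isSingleton s u = member u s and
  all (var s) (member zero (suc s) imp equal v0 (var (suc u)))

isUnorderedPair : (s u v : Fin n) → ExpFormula n
isUnorderedPair s u v = member u s and member v s and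
  all (var s) (member zero (suc s) imp (equal v0 (var (suc u)) or equal v0 (var (suc v))))

-- `IsPair` has unbounded quantifiers. Bounding them by `w` and its elements requires saying
-- separately that both sets are in `w` and that nothing else is.
isPair : (w u v : Fin n) → ExpFormula n
isPair w u v =
  ex (var w) (member zero (suc w) and isSingleton zero (suc u)) and
  ex (var w) (member zero (suc w) and isUnorderedPair zero (suc u) (suc v)) and
  all (var w) (member zero (suc w) imp
    (isSingleton zero (suc u) or isUnorderedPair zero (suc u) (suc v)))

isInImage : (u x w : Fin n) → ExpFormula n
isInImage u x w = ex (var x) (member zero (suc x) and isPair zero (suc u) (suc w))

-- The two sets are compared only below `x`. Elements of the image are always there, and the last
-- conjunct puts the elements of `t` there too.
isImage : (t x w : Fin n) → ExpFormula n
isImage t x w =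
  all (var x) ((member zero (suc t) imp isInImage zero (suc x) (suc w)) and
               (isInImage zero (suc x) (suc w) imp member zero (suc t))) and
  all (var t) (member zero (suc t) imp less v0 (var (suc x)))

module Ackermann (M : Structure 𝓛A ℓ) (M⊨BΣ₁+exp : M ⊨ BΣ₁ ∪ ｛ exp ｝) where
  open Bits M M⊨BΣ₁+exp
  open Equivalence

  N : Structure 𝓛∈ ℓ
  N = record
    { Carrier = Carrier
    ; _≈_ = _≈_
    ; isEquivalence = isEquivalence
    ; ≈-stable = ≈-stable
    ; point = 0#
    ; ⟦fun⟧ = λ ()
    ; ⟦rel⟧ = λ { memS (x ∷ y ∷ []) → Mem x y }
    ; fun-cong = λ ()
    ; rel-resp = λ { memS (p ∷ q ∷ []) → Mem-resp p q }
    ; rel-stable = λ { memS (x ∷ y ∷ []) → Mem-stable }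
    }

  private
    module N = Semantics N
    variable
      s t u v w x y : Carrier

  -- Members are smaller numbers, so a quantifier over members is a quantifier bounded by `<` with a
  -- membership guard.
  translate : {φ : Formula 𝓛∈ n} → Sets.Δ₀ φ →
              Σ[ ψ ∈ ExpFormula n ] (∀ {ρ} → ⟦ ψ ⟧ ρ ⇔ Sat N ρ φ)
  translate Sets.fls = less 0̇ 0̇ , mk⇔ (λ h → contradiction h <-irrefl) absurd
  translate (Sets.eq (var i) (var j)) = equal (var i) (var j) , mk⇔ id id
  translate (Sets.atom memS (var i ∷ var j ∷ [])) = member i j , mk⇔ id id
  translate (Sets.and δ ε) with translate δ | translate ε
  ... | φ , f | ψ , g = (φ and ψ) , mk⇔
    (λ (h , k) → to f h , to g k)
    (λ (h , k) → from f h , from g k)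
  translate (Sets.or δ ε) with translate δ | translate ε
  ... | φ , f | ψ , g = (φ or ψ) , mk⇔
    (λ h (p , q) → h (p ∘ to f , q ∘ to g))
    (λ h (p , q) → h (p ∘ from f , q ∘ from g))
  translate (Sets.imp δ ε) with translate δ | translate ε
  ... | φ , f | ψ , g = (φ imp ψ) , mk⇔
    (λ h x → to g (h (from f x)))
    (λ h x → from g (h (to f x)))
  translate (Sets.all (var i) δ) with translate δ
  ... | φ , f = all (var i) (member zero (suc i) imp φ) , mk⇔
    (λ h x x∈t → to f (h x (Mem⇒< x∈t) x∈t))
    (λ h x _ x∈t → from f (h x x∈t))
  translate (Sets.ex (var i) δ) with translate δ
  ... | φ , f = ex (var i) (member zero (suc i) and φ) , mk⇔
    (λ h k → h λ x _ (x∈t , p) → k x (x∈t , to f p))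
    (λ h k → h λ x (x∈t , p) → k x (Mem⇒< x∈t) (x∈t , from f p))

  -- A pair of implications rather than `_⇔_`, so that it is what satisfaction of `_≐｛_｝` unfolds
  -- to.
  IsSet : Carrier → (Carrier → Set ℓ) → Set ℓ
  IsSet z P = ∀ x → (Mem x z → P x) × (P x → Mem x z)

  IsSet-unique : ∀ {P} → IsSet x P → IsSet y P → x ≈ y
  IsSet-unique h k = ≤-antisym
    (⊆⇒≤ λ i i∈x → proj₂ (k i) (proj₁ (h i) i∈x))
    (⊆⇒≤ λ i i∈y → proj₂ (h i) (proj₁ (k i) i∈y))

  -- Set existence is thereby reduced to a bounded formula equivalent to `P` and a number above
  -- everything that satisfies `P`.
  bounded-set : ∀ (φ : ExpFormula (suc n)) ρ a {P : Carrier → Set ℓ} →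
                (∀ x → ⟦ φ ⟧ (x ∷ ρ) → P x) →
                (∀ x → P x → x < a × ⟦ φ ⟧ (x ∷ ρ)) →
                Ex λ z → IsSet z P
  bounded-set φ ρ a f g = exists (comprehension φ ρ a >>= λ (z , h) →
    pure (z , λ x → (λ x∈z → f x (proj₂ (to (h x) x∈z))) , λ p → from (h x) (g x p)))

  Δ₀-set : {φ : Formula 𝓛∈ (suc n)} → Sets.Δ₀ φ → ∀ ρ a →
           (∀ x → Sat N (x ∷ ρ) φ → x < a) → Ex λ z → IsSet z (λ x → Sat N (x ∷ ρ) φ)
  Δ₀-set δ ρ a h with translate δ
  ... | φ , f = bounded-set φ ρ a (λ x → to f) (λ x p → h x p , from f p)

  segment : ∀ a → Ex λ z → IsSet z (_< a)
  segment a = bounded-set (less v0 v1) (a ∷ []) a (λ x → id) (λ x x<a → x<a , x<a)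

  -- Elementary axioms, power set, separation and foundation

  extensionality : Sat N [] Extensionality
  extensionality x y h = IsSet-unique (λ u → proj₁ (h u) , proj₂ (h u)) (λ u → id , id)

  emptySet : Sat N [] EmptySet
  emptySet = Δ₀-set Sets.fls [] 0# (λ x → absurd)

  pairing : Sat N [] Pairing
  -- The set being defined is absent from the environment, so the indices are one lower than in the
  -- axiom.
  pairing x y = Δ₀-set {φ = v0 ≐ v2 ∨̇ v0 ≐ v1} (Sets.or (Sets.eq v0 v2) (Sets.eq v0 v1))
    (y ∷ x ∷ []) (x + y + 1#) λ u h → <-stable (cases h >>= λ where
      (inj₁ e) → pure (≤⇒<+1 (≤-respˡ (≈-sym e) m≤m+n))
      (inj₂ e) → pure (≤⇒<+1 (≤-respˡ (≈-sym e) m≤n+m)))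

  setDifference : Sat N [] SetDifference
  setDifference x y = Δ₀-set {φ = v0 ∈̇ v2 ∧̇ ¬̇ (v0 ∈̇ v1)}
    (Sets.and (Sets.atom memS _) (Sets.imp (Sets.atom memS _) Sets.fls))
    (y ∷ x ∷ []) x λ u (u∈x , _) → Mem⇒< u∈x

  union : Sat N [] Union
  union x = Δ₀-set {φ = Sets.∃⊲ v1 (v1 ∈̇ v0)} (Sets.ex v1 (Sets.atom memS _))
    (x ∷ []) x λ u h → <-stable (some h >>= λ (w , w∈x , u∈w) →
      pure (<-trans (Mem⇒< u∈w) (Mem⇒< w∈x)))

  powerSet : Sat N [] PowerSet
  powerSet x = Δ₀-set {φ = v0 ⊆̇ v1} (Sets.all v0 (Sets.atom memS _))
    -- By `⊆⇒≤`, a subset of `x` is a number at most `x`.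
    (x ∷ []) (x + 1#) λ u u⊆x → ≤⇒<+1 (⊆⇒≤ u⊆x)

  separation : ∀ φ → Δ₀-Separation φ → Sat N [] φ
  separation _ (sep n φ δ) = N.∀*-intro n λ ρ a → separate ρ a (translate δ)
    where
    separate : ∀ ρ a → (Σ[ ψ ∈ ExpFormula (suc n) ] (∀ {ρ} → ⟦ ψ ⟧ ρ ⇔ Sat N ρ φ)) →
               Sat N (a ∷ ρ) (∃̇ (v0 ≐｛ v0 ∈̇ v2 ∧̇ φ [ v0 ∷ params 3 ] ｝))
    separate ρ a (ψ , f) h =
      -- The set `a` stands between the element and the parameters, so `ψ` is renamed past it.
      bounded-set (member (# 0) (# 1) and ren (lift 1 suc) ψ) (a ∷ ρ) a
        {λ x → Mem x a × Sat N (x ∷ ρ) φ}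
        (λ x (x∈a , p) → x∈a , to f (to ren-ψ p))
        (λ x (x∈a , p) → Mem⇒< x∈a , x∈a , from ren-ψ (from f p))
        λ z k → h z λ x →
          (λ x∈z → let (x∈a , p) = proj₁ (k x) x∈z in x∈a , from (subst-φ z x) p) ,
          (λ (x∈a , p) → proj₂ (k x) (x∈a , to (subst-φ z x) p))
      where
      ren-ψ : ⟦ ren (lift 1 suc) ψ ⟧ (x ∷ a ∷ ρ) ⇔ ⟦ ψ ⟧ (x ∷ ρ)
      ren-ψ = ⟦ren⟧ ψ λ { zero → refl ; (suc i) → refl }
      subst-φ : ∀ z x → Sat N (x ∷ z ∷ a ∷ ρ) (φ [ v0 ∷ params 3 ]) ⇔ Sat N (x ∷ ρ) φ
      subst-φ z x = N.Sat-subst-≡ φ (v0 ∷ params 3)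
        (cong (x ∷_) (N.evals-params (x ∷ z ∷ a ∷ [])))

  -- If `x` had no minimal element, then by induction no number below `c` would belong to it: an
  -- element of `x` below `c + 1#` has only elements below `c`, which are outside `x`, and so would
  -- be minimal.
  setFoundation : Sat N [] SetFoundation
  setFoundation x h k = h λ y → induction
    (all v0 (not (member (# 0) (# 2)))) {x ∷ []}
    (λ y y<0 → contradiction y<0 0≤)
    (λ c IH y y<c+1 y∈x → k y (y∈x , λ z z∈x z∈y → contradiction z∈x
      (IH z (<-≤-trans (Mem⇒< z∈y) (<+1⇒≤ y<c+1)))))
    (y + 1#) y m<m+1

  -- Kuratowski pairs, products and images

  Pair : Carrier → Carrier → Carrier → Set ℓ
  Pair w u v = Sat N (w ∷ u ∷ v ∷ []) (IsPair v0 v1 v2)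

  Image : Carrier → Carrier → Carrier → Set ℓ
  Image t x w = Sat N (t ∷ x ∷ w ∷ []) (IsImage v0 v1 v2)

  _isOneOf_,_ : Carrier → Carrier → Carrier → Set ℓ
  t isOneOf u , v = ¬ (¬ (t ≈ u) × ¬ (t ≈ v))

  singleton : ∀ u → Ex λ s → IsSet s (_≈ u)
  singleton u = Δ₀-set {φ = v0 ≐ v1} (Sets.eq v0 v1) (u ∷ []) (u + 1#)
    λ t e → ≤⇒<+1 (≤-reflexive e)

  isSingleton⇔ : ∀ (s u : Fin n) ρ →
    ⟦ isSingleton s u ⟧ ρ ⇔ IsSet (lookup ρ s) (_≈ lookup ρ u)
  isSingleton⇔ s u ρ = mk⇔
    (λ (u∈s , h) t → (λ t∈s → h t (Mem⇒< t∈s) t∈s) ,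
                      (λ e → Mem-resp (≈-sym e) ≈-refl u∈s))
    (λ h → proj₂ (h _) ≈-refl , λ t _ t∈s → proj₁ (h t) t∈s)

  isUnorderedPair⇔ : ∀ (s u v : Fin n) ρ →
    ⟦ isUnorderedPair s u v ⟧ ρ ⇔
    IsSet (lookup ρ s) (_isOneOf lookup ρ u , lookup ρ v)
  isUnorderedPair⇔ s u v ρ = mk⇔
    (λ (u∈s , v∈s , h) t → (λ t∈s → h t (Mem⇒< t∈s) t∈s) ,
      (λ k → Mem-stable (cases k >>= λ where
        (inj₁ e) → pure (Mem-resp (≈-sym e) ≈-refl u∈s)
        (inj₂ e) → pure (Mem-resp (≈-sym e) ≈-refl v∈s))))
    (λ h → proj₂ (h _) (uncases (pure (inj₁ ≈-refl))) ,
           proj₂ (h _) (uncases (pure (inj₂ ≈-refl))) ,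
           λ t _ t∈s → proj₁ (h t) t∈s)

  -- Forward, `IsSet-unique` identifies the sets found in `w` with any others having the same
  -- elements. Backward, `singleton` and `pairing` provide the sets that `w` has to contain.
  isPair⇔ : ∀ (w u v : Fin n) ρ →
    ⟦ isPair w u v ⟧ ρ ⇔ Pair (lookup ρ w) (lookup ρ u) (lookup ρ v)
  isPair⇔ w u v ρ = mk⇔
    (λ (h₁ , h₂ , h₃) s →
      (λ s∈w (p , q) → h₃ s (Mem⇒< s∈w) s∈w (p ∘ to single , q ∘ to double)) ,
      (λ k → Mem-stable (cases k >>= λ where
        (inj₁ S) → some< h₁ >>= λ (s′ , _ , s′∈w , S′) →
          pure (Mem-resp (IsSet-unique (to single S′) S) ≈-refl s′∈w)
        (inj₂ S) → some< h₂ >>= λ (s′ , _ , s′∈w , S′) →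
          pure (Mem-resp (IsSet-unique (to double S′) S) ≈-refl s′∈w))))
    (λ h →
      (λ k → some (singleton (lookup ρ u)) λ (s , S) →
        let s∈w = proj₂ (h s) (uncases (pure (inj₁ S)))
        in k s (Mem⇒< s∈w) (s∈w , from single S)) ,
      (λ k → some (pairing (lookup ρ u) (lookup ρ v)) λ (s , S) →
        let s∈w = proj₂ (h s) (uncases (pure (inj₂ S)))
        in k s (Mem⇒< s∈w) (s∈w , from double S)) ,
      λ s _ s∈w (p , q) → proj₁ (h s) s∈w (p ∘ from single , q ∘ from double))
    where
    single : ∀ {s} → ⟦ isSingleton zero (suc u) ⟧ (s ∷ ρ) ⇔ IsSet s (_≈ lookup ρ u)
    single {s} = isSingleton⇔ zero (suc u) (s ∷ ρ)
    double : ∀ {s} → ⟦ isUnorderedPair zero (suc u) (suc v) ⟧ (s ∷ ρ) ⇔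
                     IsSet s (_isOneOf lookup ρ u , lookup ρ v)
    double {s} = isUnorderedPair⇔ zero (suc u) (suc v) (s ∷ ρ)

  Pair⇒< : Pair w u v → u < w
  Pair⇒< {w} {u} h = <-stable (some (singleton u) >>= λ (s , S) → pure
    (<-trans (Mem⇒< (proj₂ (S u) ≈-refl))
             (Mem⇒< (proj₂ (h s) (uncases (pure (inj₁ S)))))))

  Pair-components : Pair w u v → Mem s w → Mem t s → t isOneOf u , v
  Pair-components h s∈w t∈s = uncases (cases (proj₁ (h _) s∈w) >>= λ where
    (inj₁ S) → pure (inj₁ (proj₁ (S _) t∈s))
    (inj₂ S) → cases (proj₁ (S _) t∈s))

  -- All components are below `x + y`, so each element of a pair is a subset of the segment `S` and
  -- thus at most `S`. The pair is then a subset of the segment `T` and thus at most `T`.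
  cartesianProduct : Sat N [] CartesianProduct
  cartesianProduct x y k =
    some (segment (x + y)) λ (S , hS) → some (segment (S + 1#)) λ (T , hT) →
    bounded-set
      (ex v2 (member (# 0) (# 3) and
        ex v2 (member (# 0) (# 3) and isPair (# 2) (# 1) (# 0))))
      (y ∷ x ∷ []) (T + 1#)
      {λ w → Ex λ u → Mem u x × Ex λ v → Mem v y × Pair w u v}
      (λ w h → exists (some< h >>= λ (u , _ , u∈x , h′) →
        pure (u , u∈x , exists (some< h′ >>= λ (v , _ , v∈y , p) →
          pure (v , v∈y , to (isPair⇔ (# 2) (# 1) (# 0) (v ∷ u ∷ w ∷ y ∷ x ∷ [])) p)))))
      (λ w h →
        <-stable (some h >>= λ (u , u∈x , h′) → some h′ >>= λ (v , v∈y , p) →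
          pure (≤⇒<+1 (⊆⇒≤ λ s s∈w → proj₂ (hT s) (≤⇒<+1 (⊆⇒≤ λ t t∈s →
            proj₂ (hS t) (<-stable (cases (Pair-components p s∈w t∈s) >>= λ where
              (inj₁ e) → pure (<-≤-trans (<-respˡ (≈-sym e) (Mem⇒< u∈x)) m≤m+n)
              (inj₂ e) → pure (<-≤-trans (<-respˡ (≈-sym e) (Mem⇒< v∈y)) m≤n+m)))))))) ,
        λ c → some h λ (u , u∈x , h′) → c u (Mem⇒< u∈x) (u∈x , λ d →
          some h′ λ (v , v∈y , p) → d v (Mem⇒< v∈y)
            (v∈y , from (isPair⇔ (# 2) (# 1) (# 0) (v ∷ u ∷ w ∷ y ∷ x ∷ [])) p)))
      k

  _InImage_,_ : Carrier → Carrier → Carrier → Set ℓ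
  u InImage x , w = Ex λ z → Mem z x × Pair z u w

  InImage⇒< : u InImage x , w → u < x
  InImage⇒< h = <-stable (some h >>= λ (z , z∈x , p) →
    pure (<-trans (Pair⇒< p) (Mem⇒< z∈x)))

  isInImage⇔ : ∀ (u x w : Fin n) ρ →
    ⟦ isInImage u x w ⟧ ρ ⇔ (lookup ρ u InImage lookup ρ x , lookup ρ w)
  isInImage⇔ u x w ρ = mk⇔
    (λ h k → some< {t = lookup ρ x} h λ (z , _ , z∈x , q) → k z (z∈x , to p q))
    (λ h k → some h λ (z , z∈x , q) → k z (Mem⇒< z∈x) (z∈x , from p q))
    where
    p : ∀ {z} → ⟦ isPair zero (suc u) (suc w) ⟧ (z ∷ ρ) ⇔
                Pair z (lookup ρ u) (lookup ρ w)
    p {z} = isPair⇔ zero (suc u) (suc w) (z ∷ ρ)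

  isImage⇔ : ∀ (t x w : Fin n) ρ →
    ⟦ isImage t x w ⟧ ρ ⇔ Image (lookup ρ t) (lookup ρ x) (lookup ρ w)
  isImage⇔ t x w ρ = mk⇔
    (λ (h , k) u →
      (λ u∈t → to e (proj₁ (h u (k u (Mem⇒< u∈t) u∈t)) u∈t)) ,
      (λ i → proj₂ (h u (InImage⇒< i)) (from e i)))
    (λ h →
      (λ u _ → (λ u∈t → from e (proj₁ (h u) u∈t)) , (λ i → proj₂ (h u) (to e i))) ,
      (λ u _ u∈t → InImage⇒< (proj₁ (h u) u∈t)))
    where
    e : ∀ {u} → ⟦ isInImage zero (suc x) (suc w) ⟧ (u ∷ ρ) ⇔
                (u InImage lookup ρ x , lookup ρ w)
    e {u} = isInImage⇔ zero (suc x) (suc w) (u ∷ ρ)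

  -- Elements of an image are first components of pairs in `x`, hence below `x`. So an image is a
  -- subset of the segment `S` and at most `S`.
  r₈ : Sat N [] R₈
  r₈ x y k = some (segment x) λ (S , hS) →
    bounded-set (ex v1 (member (# 0) (# 2) and isImage (# 1) (# 3) (# 0)))
      (y ∷ x ∷ []) (S + 1#)
      {λ t → Ex λ w → Mem w y × Image t x w}
      (λ t h → exists (some< h >>= λ (w , _ , w∈y , i) →
        pure (w , w∈y , to (isImage⇔ (# 1) (# 3) (# 0) (w ∷ t ∷ y ∷ x ∷ [])) i)))
      (λ t h →
        <-stable (some h >>= λ (w , w∈y , i) → pure (≤⇒<+1 (⊆⇒≤ λ u u∈t →
          proj₂ (hS u) (<-stable (some (proj₁ (i u) u∈t) >>= λ (z , z∈x , p) →
            pure (<-trans (Pair⇒< p) (Mem⇒< z∈x))))))) ,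
        λ c → some h λ (w , w∈y , i) → c w (Mem⇒< w∈y)
          (w∈y , from (isImage⇔ (# 1) (# 3) (# 0) (w ∷ t ∷ y ∷ x ∷ [])) i))
      k

  -- Transitive closure

  _⊆_ : Carrier → Carrier → Set ℓ
  x ⊆ y = ∀ i → Mem i x → Mem i y

  Trans : Carrier → Set ℓ
  Trans s = ∀ w → Mem w s → w ⊆ s

  -- The transitive closure of x lies in the set S of all numbers below x, and
  -- it is enough to intersect the transitive sets s ⊇ x with s ≤ S.
  transitiveClosure : Sat N [] TCl
  transitiveClosure x k = some (segment x) λ (S , hS) →
    let (ψ , f) = translate δ in
    some (bounded-set (less v0 v2 and all (v1 +̇ 1̇) ψ) (S ∷ x ∷ []) x
      {λ u → u < x × ∀ s → s < S + 1# → x ⊆ s × Trans s → Mem u s}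
      (λ u (u<x , h) → u<x , λ s s≤S → to (f {s ∷ u ∷ S ∷ x ∷ []}) (h s s≤S))
      (λ u (u<x , h) → u<x , u<x , λ s s≤S → from (f {s ∷ u ∷ S ∷ x ∷ []}) (h s s≤S)))
      λ (t , ht) →
    k t ( (λ u u∈x → proj₂ (ht u) (Mem⇒< u∈x , λ s _ (x⊆s , _) → x⊆s u u∈x))
        , (λ w w∈t u u∈w →
             let (w<x , h) = proj₁ (ht w) w∈t in
             proj₂ (ht u) ( <-trans (Mem⇒< u∈w) w<x
                          , λ s s≤S c → proj₂ c w (h s s≤S c) u u∈w))
        , λ s (x⊆s , s-trans) u u∈t → Mem-stable
            (some (bounded-set (less v0 v1 and member (# 0) (# 2)) (x ∷ s ∷ []) x
                     {λ i → i < x × Mem i s}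
                     (λ i → id) (λ i (i<x , i∈s) → i<x , i<x , i∈s)) >>= λ (s′ , hs′) →
             pure (proj₂ (proj₁ (hs′ u) (proj₂ (proj₁ (ht u) u∈t) s′
               (≤⇒<+1 (⊆⇒≤ λ i i∈s′ → proj₂ (hS i) (proj₁ (proj₁ (hs′ i) i∈s′))))
               ( (λ i i∈x → proj₂ (hs′ i) (Mem⇒< i∈x , x⊆s i i∈x))
               , λ w w∈s′ i i∈w →
                   let (w<x , w∈s) = proj₁ (hs′ w) w∈s′ in
                   proj₂ (hs′ i) (<-trans (Mem⇒< i∈w) w<x , s-trans w w∈s i i∈w)))))))
    where
    δ : Sets.Δ₀ (v3 ⊆̇ v0 ∧̇ Transitive v0 ⇒̇ v1 ∈̇ v0)
    δ = Sets.imp (Sets.and (Sets.all v3 (Sets.atom memS _))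
                           (Sets.all v0 (Sets.all v0 (Sets.atom memS _))))
                 (Sets.atom memS _)

  -- Σ₁ collection for sets

  -- The renaming `f` lets the formula be read in a longer environment, as `collection` requires for
  -- inserting the bound `a`.
  Σ₁-set : {φ : Formula 𝓛∈ m} → Sets.Σ₁ φ → (f : Fin m → Fin n) →
           Σ₁-Definable (λ ρ → Sat N (tabulate (lookup ρ ∘ f)) φ)
  Σ₁-set {φ = φ} (Sets.bounded δ) f with translate δ
  ... | ψ , g = Σ₁-resp (λ {ρ} h → to g (to (⟦ren⟧ ψ (e ρ)) h))
                        (λ {ρ} h → pure (from (⟦ren⟧ ψ (e ρ)) (from g h)))
                        Σ₁-⟦ ren f ψ ⟧
    where
    e : ∀ ρ i → lookup ρ (f i) ≡ lookup (tabulate (lookup ρ ∘ f)) i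
    e ρ i = sym (lookup∘tabulate (lookup ρ ∘ f) i)
  Σ₁-set (Sets.exists σ) f = Σ₁-∃ (Σ₁-set σ (lift 1 f))

  -- Arithmetical collection runs over all `x < a`, not just the members of `a`. The first disjunct
  -- of `q` covers the other numbers; it is Σ₁ because membership is Δ₁.
  collection : ∀ φ → Sets.Coll Sets.Σ₁ φ → Sat N [] φ
  collection _ (Sets.coll n φ σ) = N.∀*-intro n λ ρ a h k →
    let
      p = Σ₁-set σ (lift 2 suc)
      q = Σ₁-∨ Σ₁-¬⟦ member (# 0) (# 1) ⟧ (Σ₁-∃ p)
      tab : ∀ x y → tabulate (lookup (y ∷ x ∷ a ∷ ρ) ∘ lift 2 suc) ≡ y ∷ x ∷ ρ
      tab x y = cong (λ τ → y ∷ x ∷ τ) (tabulate∘lookup ρ)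
      at₃ : ∀ x y → Sat N (y ∷ x ∷ a ∷ ρ) (φ [ v0 ∷ v1 ∷ params 3 ]) ⇔
                    Sat N (y ∷ x ∷ ρ) φ
      at₃ x y = N.Sat-subst-≡ φ (v0 ∷ v1 ∷ params 3)
        (cong (λ τ → y ∷ x ∷ τ) (N.evals-params (y ∷ x ∷ a ∷ [])))
      at₄ : ∀ x y b → Sat N (y ∷ x ∷ b ∷ a ∷ ρ) (φ [ v0 ∷ v1 ∷ params 4 ]) ⇔
                      Sat N (y ∷ x ∷ ρ) φ
      at₄ x y b = N.Sat-subst-≡ φ (v0 ∷ v1 ∷ params 4)
        (cong (λ τ → y ∷ x ∷ τ) (N.evals-params (y ∷ x ∷ b ∷ a ∷ [])))
    in collect q {a ∷ ρ} {a}
      (λ x _ → lem (Mem x a) >>= λ where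
        (inj₁ x∈a) → pure (inj₂ (exists (some (h x x∈a) >>= λ (y , r) → pure
          (y , subst (λ τ → Sat N τ φ) (sym (tab x y)) (to (at₃ x y) r)))))
        (inj₂ x∉a) → pure (inj₁ x∉a)) λ (w , g) →
    -- The formula made by `Σ₁-∃` already contains `y < w`, so the segment below the common witness
    -- `w` holds a suitable `y` for each `x`.
    some (segment w) λ (b , hb) → k b λ x x∈a → exists
      (cases (g x (Mem⇒< x∈a)) >>= λ where
        (inj₁ r) → contradiction x∈a
          (Σ₁-Definable.sound Σ₁-¬⟦ member (# 0) (# 1) ⟧ {x ∷ a ∷ ρ} w r)
        (inj₂ r) → some r >>= λ (y , y<w , r′) → pure
          ( y
          , proj₂ (hb y) (W-elim {ρ = x ∷ a ∷ ρ} y<w)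
          , from (at₄ x y b) (subst (λ τ → Sat N τ φ) (tab x y)
              (Σ₁-Definable.sound p {y ∷ x ∷ a ∷ ρ} w r′))))

  N⊨ : N ⊨ T₀ ∪ ｛ PowerSet ｝ ∪ Sets.Coll Sets.Σ₁
  N⊨ φ (inj₂ (inj₂ h))    = collection φ h
  N⊨ _ (inj₂ (inj₁ refl)) = powerSet
  N⊨ _ (inj₁ (inj₂ (inj₂ refl))) = transitiveClosure
  N⊨ _ (inj₁ (inj₂ (inj₁ refl))) = setFoundation
  N⊨ _ (inj₁ (inj₁ (inj₂ refl))) = r₈
  N⊨ _ (inj₁ (inj₁ (inj₁ (inj₂ refl)))) = cartesianProduct
  N⊨ φ (inj₁ (inj₁ (inj₁ (inj₁ (inj₂ h))))) = separation φ h
  N⊨ φ (inj₁ (inj₁ (inj₁ (inj₁ (inj₁ h))))) = basic φ h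
    where
    basic : N ⊨ S₀
    basic _ (inj₁ refl)                      = extensionality
    basic _ (inj₂ (inj₁ refl))               = emptySet
    basic _ (inj₂ (inj₂ (inj₁ refl)))        = pairing
    basic _ (inj₂ (inj₂ (inj₂ (inj₁ refl)))) = setDifference
    basic _ (inj₂ (inj₂ (inj₂ (inj₂ refl)))) = union

ackermann : Interpretation 𝓛∈ 𝓛A
ackermann = record
  { domF = v0 ≐ v0
  ; eqF  = v0 ≐ v1
  ; funF = λ ()
  ; relF = λ { memS → Member v0 v1 }
  }

theorem3p4 : (BΣ₁ ∪ ｛ exp ｝) Interprets (T₀ ∪ ｛ PowerSet ｝ ∪ Sets.Coll Sets.Σ₁)
theorem3p4 = record
  { interpretation = ackermann
  ; correct = λ M M⊨ →
      let open Ackermann M M⊨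
          ≈-refl = IsEquivalence.refl (Structure.isEquivalence M)
      in
      N
    , record
      { quot      = proj₁
      ; quot-surj = λ y → (y , ≈-refl) , ≈-refl
      ; quot-eq   = λ _ _ → mk⇔ id id
      ; quot-fun  = λ ()
      ; quot-rel  = λ { memS (x ∷ y ∷ []) → mk⇔ id id }
      }
    , N⊨
  }
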